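{- For any convex polygon $P$ and any $k\ge 2$: (1) $k\text{ -DIR}\not\subseteq P_{hom}$; (2) $P_{hom}\not\subseteq k\text{ -DIR}$.
   Context: All graphs are finite. A polygon is a closed convex polygon in $\mathbb{R}^2$. For a finite collection of sets, its intersection graph has one vertex for each member of the collection, and two distinct vertices are adjacent iff the corresponding sets have nonempty intersection. $P_{hom}$ is the class of intersection graphs of finite collections of sets homothetic to $P$, i.e. sets obtained from $P$ by (positive) scaling and/or translation. $k\text{ -DIR}$ is the class of intersection graphs of finite collections of straight-line segments in the plane in which all segments are parallel to at most $k$ directions. -}

module Defs where

open import Algebra.Bundles using (CommutativeMonoid)
open import Algebra.Bundles.Raw using (RawRing)
import Algebra.Definitions.RawMonoid as RawMonoidDefs
import Algebra.Properties.CommutativeSemigroup as CommutativeSemigroupProperties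
open import Data.Fin.Base using (Fin)
open import Data.Nat.Base as ℕ using (ℕ)
import Data.Nat.Properties as ℕ
open import Data.Product.Base using (Σ-syntax; ∃; ∃-syntax; _×_; _,_; proj₁; proj₂)
open import Data.Rational.Base as ℚ using (ℚ; 0ℚ; 1ℚ; ½; ∣_∣)
import Data.Rational.Properties as ℚ
open import Data.Vec.Functional using (Vector)
open import Function.Bundles using (_⇔_)
open import Level using (0ℓ; suc)
open import Relation.Binary.Core using (Rel)
open import Relation.Binary.Definitions using (Decidable; Irreflexive; Symmetric)
open import Relation.Binary.PropositionalEquality
  using (_≡_; _≢_; refl; sym; trans; cong; cong₂; subst; module ≡-Reasoning)
open import Relation.Nullary.Negation.Core using (¬_)
open import Relation.Unary using (Pred; _≐_; _≬_)

------------------------------------------------------------------------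
-- The real numbers: Cauchy sequences of rationals, with setoid equality.

Eventually : Pred ℕ 0ℓ → Set
Eventually A = ∃[ N ] ∀ n → N ℕ.≤ n → A n

IsCauchy : Pred (ℕ → ℚ) 0ℓ
IsCauchy f = ∀ ε → 0ℚ ℚ.< ε →
  ∃[ N ] ∀ m n → N ℕ.≤ m → N ℕ.≤ n → ∣ f m ℚ.- f n ∣ ℚ.< ε

abstract

  private
    open CommutativeSemigroupProperties
      (CommutativeMonoid.commutativeSemigroup ℚ.+-0-commutativeMonoid) using (interchange)

    half-pos : ∀ {ε} → 0ℚ ℚ.< ε → 0ℚ ℚ.< ½ ℚ.* ε
    half-pos {ε} 0<ε =
      subst (ℚ._< ½ ℚ.* ε) (ℚ.*-zeroʳ ½) (ℚ.*-monoʳ-<-pos ½ 0<ε)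

    half+half : ∀ ε → ½ ℚ.* ε ℚ.+ ½ ℚ.* ε ≡ ε
    half+half ε = trans (sym (ℚ.*-distribʳ-+ ε ½ ½)) (ℚ.*-identityˡ ε)

    +-regroup : ∀ a b c d →
      (a ℚ.+ b) ℚ.- (c ℚ.+ d) ≡ (a ℚ.- c) ℚ.+ (b ℚ.- d)
    +-regroup a b c d = trans
      (cong (a ℚ.+ b ℚ.+_) (ℚ.neg-distrib-+ c d))
      (interchange a b (ℚ.- c) (ℚ.- d))

    neg-regroup : ∀ a b → (ℚ.- a) ℚ.- (ℚ.- b) ≡ ℚ.- (a ℚ.- b)
    neg-regroup a b = sym (ℚ.neg-distrib-+ a (ℚ.- b))

    telescope : ∀ a b c → a ℚ.- c ≡ (a ℚ.- b) ℚ.+ (b ℚ.- c)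
    telescope a b c = sym (begin
      (a ℚ.- b) ℚ.+ (b ℚ.- c)          ≡⟨ ℚ.+-assoc a (ℚ.- b) (b ℚ.- c) ⟩
      a ℚ.+ (ℚ.- b ℚ.+ (b ℚ.- c))      ≡⟨ cong (a ℚ.+_) (sym (ℚ.+-assoc (ℚ.- b) b (ℚ.- c))) ⟩
      a ℚ.+ ((ℚ.- b ℚ.+ b) ℚ.- c)      ≡⟨ cong (λ z → a ℚ.+ (z ℚ.- c)) (ℚ.+-inverseˡ b) ⟩
      a ℚ.+ (0ℚ ℚ.- c)                 ≡⟨ cong (a ℚ.+_) (ℚ.+-identityˡ (ℚ.- c)) ⟩
      a ℚ.- c                          ∎)
      where open ≡-Reasoning

    *-distribˡ-- : ∀ a b c → a ℚ.* b ℚ.- a ℚ.* c ≡ a ℚ.* (b ℚ.- c)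
    *-distribˡ-- a b c = trans
      (cong (a ℚ.* b ℚ.+_) (ℚ.neg-distribʳ-* a c))
      (sym (ℚ.*-distribˡ-+ a b (ℚ.- c)))

    *-regroup : ∀ a b c d →
      a ℚ.* b ℚ.- c ℚ.* d ≡ a ℚ.* (b ℚ.- d) ℚ.+ d ℚ.* (a ℚ.- c)
    *-regroup a b c d = trans (telescope (a ℚ.* b) (a ℚ.* d) (c ℚ.* d)) (cong₂ ℚ._+_
      (*-distribˡ-- a b d)
      (trans (cong₂ ℚ._-_ (ℚ.*-comm a d) (ℚ.*-comm c d)) (*-distribˡ-- d a c)))

    sub-add : ∀ a b → a ≡ (a ℚ.- b) ℚ.+ b
    sub-add a b = sym (trans (ℚ.+-assoc a (ℚ.- b) b)
      (trans (cong (a ℚ.+_) (ℚ.+-inverseˡ b)) (ℚ.+-identityʳ a)))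

    bound : ∀ {f} → IsCauchy f →
      Σ[ B ∈ ℚ ] 0ℚ ℚ.< B × Eventually (λ n → ∣ f n ∣ ℚ.≤ B)
    bound {f} cf with cf 1ℚ (ℚ.positive⁻¹ 1ℚ)
    ... | N , close =
      1ℚ ℚ.+ ∣ f N ∣ ,
      ℚ.+-mono-<-≤ (ℚ.positive⁻¹ 1ℚ) (ℚ.0≤∣p∣ (f N)) ,
      N , λ n N≤n → begin
        ∣ f n ∣                        ≡⟨ cong ∣_∣ (sub-add (f n) (f N)) ⟩
        ∣ (f n ℚ.- f N) ℚ.+ f N ∣      ≤⟨ ℚ.∣p+q∣≤∣p∣+∣q∣ (f n ℚ.- f N) (f N) ⟩
        ∣ f n ℚ.- f N ∣ ℚ.+ ∣ f N ∣    ≤⟨ ℚ.+-monoˡ-≤ ∣ f N ∣ (ℚ.<⇒≤ (close n N N≤n ℕ.≤-refl)) ⟩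
        1ℚ ℚ.+ ∣ f N ∣                 ∎
      where open ℚ.≤-Reasoning

    product-bound : ∀ p q B δ → 0ℚ ℚ.< B → ∣ p ∣ ℚ.≤ B → ∣ q ∣ ℚ.< δ →
      ∣ p ℚ.* q ∣ ℚ.< B ℚ.* δ
    product-bound p q B δ 0<B p≤B q<δ = begin-strict
      ∣ p ℚ.* q ∣      ≡⟨ ℚ.∣p*q∣≡∣p∣*∣q∣ p q ⟩
      ∣ p ∣ ℚ.* ∣ q ∣  ≤⟨ ℚ.*-monoʳ-≤-nonNeg ∣ q ∣ {{ℚ.∣-∣-nonNeg q}} p≤B ⟩
      B ℚ.* ∣ q ∣      <⟨ ℚ.*-monoʳ-<-pos B {{ℚ.positive 0<B}} q<δ ⟩
      B ℚ.* δ          ∎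
      where open ℚ.≤-Reasoning

    product-difference : ∀ a b c d B C δ → 0ℚ ℚ.< B → 0ℚ ℚ.< C →
      ∣ a ∣ ℚ.≤ B → ∣ d ∣ ℚ.≤ C → ∣ a ℚ.- c ∣ ℚ.< δ → ∣ b ℚ.- d ∣ ℚ.< δ →
      ∣ a ℚ.* b ℚ.- c ℚ.* d ∣ ℚ.< (B ℚ.+ C) ℚ.* δ
    product-difference a b c d B C δ 0<B 0<C a≤B d≤C ac<δ bd<δ = begin-strict
      ∣ a ℚ.* b ℚ.- c ℚ.* d ∣
        ≡⟨ cong ∣_∣ (*-regroup a b c d) ⟩
      ∣ a ℚ.* (b ℚ.- d) ℚ.+ d ℚ.* (a ℚ.- c) ∣
        ≤⟨ ℚ.∣p+q∣≤∣p∣+∣q∣ (a ℚ.* (b ℚ.- d)) (d ℚ.* (a ℚ.- c)) ⟩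
      ∣ a ℚ.* (b ℚ.- d) ∣ ℚ.+ ∣ d ℚ.* (a ℚ.- c) ∣
        <⟨ ℚ.+-mono-< (product-bound a (b ℚ.- d) B δ 0<B a≤B bd<δ)
                      (product-bound d (a ℚ.- c) C δ 0<C d≤C ac<δ) ⟩
      B ℚ.* δ ℚ.+ C ℚ.* δ
        ≡⟨ sym (ℚ.*-distribʳ-+ δ B C) ⟩
      (B ℚ.+ C) ℚ.* δ ∎
      where open ℚ.≤-Reasoning

    quotient : ∀ D ε → 0ℚ ℚ.< D → 0ℚ ℚ.< ε → Σ[ δ ∈ ℚ ] 0ℚ ℚ.< δ × D ℚ.* δ ≡ ε
    quotient D ε 0<D 0<ε =
      D⁻¹ ℚ.* ε ,
      subst (ℚ._< D⁻¹ ℚ.* ε) (ℚ.*-zeroʳ D⁻¹) (ℚ.*-monoʳ-<-pos D⁻¹ {{ℚ.1/pos⇒pos D}} 0<ε) ,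
      trans (sym (ℚ.*-assoc D D⁻¹ ε))
        (trans (cong (ℚ._* ε) (ℚ.*-inverseʳ D)) (ℚ.*-identityˡ ε))
      where
      instance
        D>0 : ℚ.Positive D
        D>0 = ℚ.positive 0<D

        D≢0 : ℚ.NonZero D
        D≢0 = ℚ.pos⇒nonZero D

      D⁻¹ : ℚ
      D⁻¹ = ℚ.1/ D

  const-cauchy : ∀ q → IsCauchy (λ _ → q)
  const-cauchy q ε 0<ε =
    0 , λ _ _ _ _ → subst (λ r → ∣ r ∣ ℚ.< ε) (sym (ℚ.+-inverseʳ q)) 0<ε

  +-cauchy : ∀ f g → IsCauchy f → IsCauchy g → IsCauchy (λ n → f n ℚ.+ g n)
  +-cauchy f g cf cg ε 0<ε
    with cf (½ ℚ.* ε) (half-pos 0<ε) | cg (½ ℚ.* ε) (half-pos 0<ε)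
  ... | M , closef | N , closeg = M ℕ.⊔ N , λ m n p q → begin-strict
    ∣ (f m ℚ.+ g m) ℚ.- (f n ℚ.+ g n) ∣    ≡⟨ cong ∣_∣ (+-regroup (f m) (g m) (f n) (g n)) ⟩
    ∣ (f m ℚ.- f n) ℚ.+ (g m ℚ.- g n) ∣    ≤⟨ ℚ.∣p+q∣≤∣p∣+∣q∣ (f m ℚ.- f n) (g m ℚ.- g n) ⟩
    ∣ f m ℚ.- f n ∣ ℚ.+ ∣ g m ℚ.- g n ∣    <⟨ ℚ.+-mono-<
      (closef m n (ℕ.m⊔n≤o⇒m≤o M N p) (ℕ.m⊔n≤o⇒m≤o M N q))
      (closeg m n (ℕ.m⊔n≤o⇒n≤o M N p) (ℕ.m⊔n≤o⇒n≤o M N q)) ⟩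
    ½ ℚ.* ε ℚ.+ ½ ℚ.* ε                    ≡⟨ half+half ε ⟩
    ε                                      ∎
    where open ℚ.≤-Reasoning

  neg-cauchy : ∀ f → IsCauchy f → IsCauchy (λ n → ℚ.- f n)
  neg-cauchy f cf ε 0<ε with cf ε 0<ε
  ... | N , close = N , λ m n p q → subst (ℚ._< ε)
    (sym (trans (cong ∣_∣ (neg-regroup (f m) (f n))) (ℚ.∣-p∣≡∣p∣ (f m ℚ.- f n))))
    (close m n p q)

  *-cauchy : ∀ f g → IsCauchy f → IsCauchy g → IsCauchy (λ n → f n ℚ.* g n)
  *-cauchy f g cf cg ε 0<ε =
    let B , 0<B , K , f≤B = bound cf
        C , 0<C , L , g≤C = bound cg
        δ , 0<δ , eq = quotient (B ℚ.+ C) ε (ℚ.+-mono-< 0<B 0<C) 0<ε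
        M , closef = cf δ 0<δ
        N , closeg = cg δ 0<δ
    in (K ℕ.⊔ L) ℕ.⊔ (M ℕ.⊔ N) , λ m n p q →
      let p₁ = ℕ.m⊔n≤o⇒m≤o (K ℕ.⊔ L) (M ℕ.⊔ N) p
          p₂ = ℕ.m⊔n≤o⇒n≤o (K ℕ.⊔ L) (M ℕ.⊔ N) p
          q₁ = ℕ.m⊔n≤o⇒m≤o (K ℕ.⊔ L) (M ℕ.⊔ N) q
          q₂ = ℕ.m⊔n≤o⇒n≤o (K ℕ.⊔ L) (M ℕ.⊔ N) q
      in subst (∣ f m ℚ.* g m ℚ.- f n ℚ.* g n ∣ ℚ.<_) eq
        (product-difference (f m) (g m) (f n) (g n) B C δ 0<B 0<C
          (f≤B m (ℕ.m⊔n≤o⇒m≤o K L p₁))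
          (g≤C n (ℕ.m⊔n≤o⇒n≤o K L q₁))
          (closef m n (ℕ.m⊔n≤o⇒m≤o M N p₂) (ℕ.m⊔n≤o⇒m≤o M N q₂))
          (closeg m n (ℕ.m⊔n≤o⇒n≤o M N p₂) (ℕ.m⊔n≤o⇒n≤o M N q₂)))

record ℝ : Set where
  constructor mkℝ
  field
    seq      : ℕ → ℚ
    isCauchy : IsCauchy seq
open ℝ public

infix  4 _≈_ _<_ _≤_
infixl 6 _+_ _-_
infixl 7 _*_
infix  8 -_

record _≈_ (x y : ℝ) : Set where
  constructor mk≈
  field
    close : ∀ ε → 0ℚ ℚ.< ε → Eventually (λ n → ∣ seq x n ℚ.- seq y n ∣ ℚ.< ε)

record _<_ (x y : ℝ) : Set where
  constructor mk<
  field
    gap      : ℚ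
    0<gap    : 0ℚ ℚ.< gap
    separate : Eventually (λ n → seq x n ℚ.+ gap ℚ.≤ seq y n)

_≤_ : Rel ℝ 0ℓ
x ≤ y = ¬ (y < x)

fromℚ : ℚ → ℝ
fromℚ q = mkℝ (λ _ → q) (const-cauchy q)

0ℝ 1ℝ : ℝ
0ℝ = fromℚ 0ℚ
1ℝ = fromℚ 1ℚ

_+_ _*_ : ℝ → ℝ → ℝ
x + y = mkℝ (λ n → seq x n ℚ.+ seq y n) (+-cauchy (seq x) (seq y) (isCauchy x) (isCauchy y))
x * y = mkℝ (λ n → seq x n ℚ.* seq y n) (*-cauchy (seq x) (seq y) (isCauchy x) (isCauchy y))

-_ : ℝ → ℝ
- x = mkℝ (λ n → ℚ.- seq x n) (neg-cauchy (seq x) (isCauchy x))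

_-_ : ℝ → ℝ → ℝ
x - y = x + (- y)

ℝ-rawRing : RawRing 0ℓ 0ℓ
ℝ-rawRing = record
  { Carrier = ℝ ; _≈_ = _≈_ ; _+_ = _+_ ; _*_ = _*_ ; -_ = -_ ; 0# = 0ℝ ; 1# = 1ℝ }

open RawMonoidDefs (RawRing.+-rawMonoid ℝ-rawRing) public using (sum)

------------------------------------------------------------------------
-- The plane

ℝ² : Set
ℝ² = ℝ × ℝ

infix  4 _≈²_ _∥_
infixl 6 _+²_ _-²_
infixr 7 _•_

_≈²_ : Rel ℝ² 0ℓ
(x , y) ≈² (x′ , y′) = x ≈ x′ × y ≈ y′

0² : ℝ²
0² = 0ℝ , 0ℝ

_+²_ _-²_ : ℝ² → ℝ² → ℝ²
(x , y) +² (x′ , y′) = x + x′ , y + y′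
(x , y) -² (x′ , y′) = x - x′ , y - y′

_•_ : ℝ → ℝ² → ℝ²
c • (x , y) = c * x , c * y

_∥_ : Rel ℝ² 0ℓ
(x , y) ∥ (x′ , y′) = x * y′ ≈ y * x′

Collinear : ℝ² → ℝ² → ℝ² → Set
Collinear p q r = (q -² p) ∥ (r -² p)

PlaneSet : Set₁
PlaneSet = Pred ℝ² 0ℓ

ConvexHull : ∀ {n} → Vector ℝ² n → PlaneSet
ConvexHull {n} v p = Σ[ w ∈ Vector ℝ n ]
    (∀ i → 0ℝ ≤ w i)
  × sum w ≈ 1ℝ
  × p ≈² (sum (λ i → w i * proj₁ (v i)) , sum (λ i → w i * proj₂ (v i)))

Segment : ℝ² → ℝ² → PlaneSet
Segment a b p = Σ[ t ∈ ℝ ] 0ℝ ≤ t × t ≤ 1ℝ × p ≈² a +² t • (b -² a)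

-- A closed convex polygon is the convex hull of finitely many points that do
-- not all lie on one line; degenerate polygons (a point or a segment) are
-- thereby excluded.
record Polygon : Set where
  field
    size          : ℕ
    points        : Vector ℝ² size
    nondegenerate : ∃[ i ] ∃[ j ] ∃[ l ] ¬ Collinear (points i) (points j) (points l)

  region : PlaneSet
  region = ConvexHull points
open Polygon public using (region)

HomotheticTo : PlaneSet → Pred PlaneSet 0ℓ
HomotheticTo A S = Σ[ s ∈ ℝ ] Σ[ t ∈ ℝ² ]
  0ℝ < s × S ≐ (λ q → Σ[ p ∈ ℝ² ] A p × q ≈² s • p +² t)

SegmentInDirection : ℝ² → Pred PlaneSet 0ℓ
SegmentInDirection d S = Σ[ a ∈ ℝ² ] Σ[ b ∈ ℝ² ]
  ¬ (a ≈² b) × (b -² a) ∥ d × S ≐ Segment a b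

------------------------------------------------------------------------
-- Graphs and intersection graphs

-- Adjacency is required to be decidable because a finite graph is finite data.
record Graph : Set₁ where
  field
    order     : ℕ
    Adj       : Rel (Fin order) 0ℓ
    adj?      : Decidable Adj
    symmetric : Symmetric Adj
    loopless  : Irreflexive _≡_ Adj
open Graph public using (order; Adj)

GraphClass : Set₂
GraphClass = Pred Graph (suc 0ℓ)

IsIntersectionGraphOf : (G : Graph) → Vector PlaneSet (order G) → Set
IsIntersectionGraphOf G F = ∀ u v → Adj G u v ⇔ (u ≢ v × F u ≬ F v)

-- A finite collection is an indexed family, so a set may occur repeatedly.
IntersectionGraphs : Pred PlaneSet 0ℓ → GraphClass
IntersectionGraphs 𝒮 G =
  Σ[ F ∈ Vector PlaneSet (order G) ] (∀ v → 𝒮 (F v)) × IsIntersectionGraphOf G F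

_hom : Polygon → GraphClass
P hom = IntersectionGraphs (HomotheticTo (region P))

_-DIR : ℕ → GraphClass
(k -DIR) G = Σ[ d ∈ Vector ℝ² k ]
    (∀ i → ¬ (d i ≈² 0²))
  × IntersectionGraphs (λ S → ∃[ i ] SegmentInDirection (d i) S) G

{-# OPTIONS --safe #-}
module Submission where

-- Both parts are negations, so classical case distinctions can be made under ¬ ¬.
--
-- (1) K_{n,n} is the intersection graph of n horizontal and n vertical segments. Among
-- homothets of P representing it, take a smallest one: the n vertices on the other side
-- are pairwise disjoint homothets that are at least as large and meet it. Shrinking each
-- towards a common point gives n disjoint translates near a fixed place, and there is
-- only room for boundedly many of those.
--
-- (2) Take a triangle with a pendant vertex at each corner, and join its corners to all
-- nodes of the comparability graph of a complete binary tree of height k. Colouring the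
-- nodes by direction produces a node and two incomparable descendants, all parallel.
-- These three lie on one line, so a corner segment meeting both descendants, which are
-- disjoint, must be parallel to them. Hence the corners lie on one line, but of three
-- pairwise meeting intervals one is covered by the other two, leaving no room for its
-- pendant. With homothets of P, three slightly shifted copies of P serve as corners, each
-- having a point outside the others, and the tree is nested in their common interior.

open import Defs
open import Algebra.Bundles using (CommutativeRing)
import Algebra.Solver.Ring as RingSolver
open import Algebra.Solver.Ring.AlmostCommutativeRing
  using (fromCommutativeRing; _-Raw-AlmostCommutative⟶_)
open import Data.Empty using (⊥; ⊥-elim)
open import Data.Fin.Base using (Fin; zero; suc; toℕ; combine; punchOut)
open import Data.Fin.Patterns using (0F; 1F; 2F)
import Data.Fin.Properties as Fin
import Data.Integer.Base as ℤ
import Data.Integer.Properties as ℤ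
open import Data.Maybe.Base using (Maybe; just; nothing)
open import Data.Nat.Base as ℕ using (zero; suc; s≤s)
open import Data.Nat.Base using (ℕ) renaming (_≤_ to _≤ℕ_)
import Data.Nat.Properties as ℕ
open import Data.Product.Base using (Σ-syntax; ∃-syntax; _,_; proj₁; proj₂)
open import Data.Product.Base using (_×_)
open import Data.Rational.Base as ℚ using (ℚ; 0ℚ; 1ℚ; ½; ∣_∣; mkℚ)
import Data.Rational.Properties as ℚ
open import Data.Rational.Solver using (module +-*-Solver)
import Data.Rational.Unnormalised.Base as ℚᵘ
import Data.Rational.Unnormalised.Properties as ℚᵘ
open import Data.Sum.Base using (_⊎_; inj₁; inj₂)
open import Data.Sum.Function.Propositional using (_⊎-↔_)
open import Data.Unit.Base using (⊤; tt)
open import Data.Vec.Functional using (Vector)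
open import Function.Base using (_∘_)
open import Function.Bundles using (_↔_; mk⇔; module Inverse; module Equivalence)
open import Function.Construct.Composition using (_↔-∘_)
open import Function.Properties.Inverse using (↔-refl)
open import Level using (0ℓ)
open import Relation.Binary.Core using (Rel)
open import Relation.Binary.Definitions
  using (Decidable; Irreflexive; Symmetric; tri<; tri≈; tri>)
open import Relation.Binary.PropositionalEquality
  using (_≡_; _≢_; refl; sym; trans; cong; cong₂; subst; subst₂)
open import Relation.Nullary using (¬_; yes; no)
open import Relation.Nullary.Decidable using (¬?; decidable-stable)
open import Relation.Unary using (_≬_; _⊆_)
open import Relation.Unary using (_⊈_)

-- The reals as an ordered field

-- Representability by homothets is preserved by invertible affine maps. Moving a triangle of points
-- of `P` to a standard position yields a convex body between the square [-1,1]² and some square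
-- [-R,R]². Containment and disjointness are then checked on axis-parallel squares, and `R` controls
-- every size: the number of cells in (1), the pendants and the nesting ratio of the tree in (2).
-- The tree serves to force two disjoint segments onto one line although each corner meets both;
-- this takes a third segment that is parallel to them and meets both, which is what a monochromatic
-- fork supplies. Comparing two reals, inverting a number known only to be nonzero and choosing the
-- index of a largest value are available only under ¬ ¬. Since `≤` is a negation and `x ≈ 0ℝ` is
-- stable, conclusions of these forms can be taken out of such arguments. Witnesses cannot, so
-- lemmas that obtain points or reciprocals by such choices conclude with ¬ ¬ and are used in
-- continuation style.

halve : ∀ {ε} → 0ℚ ℚ.< ε → Σ[ δ ∈ ℚ ] 0ℚ ℚ.< δ × δ ℚ.+ δ ≡ ε
halve {ε} 0<ε = ½ ℚ.* ε ,
  subst (ℚ._< ½ ℚ.* ε) (ℚ.*-zeroʳ ½) (ℚ.*-monoʳ-<-pos ½ 0<ε) ,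
  trans (sym (ℚ.*-distribʳ-+ ε ½ ½)) (ℚ.*-identityˡ ε)

p≤∣p∣ : ∀ p → p ℚ.≤ ∣ p ∣
p≤∣p∣ p with ℚ.≤-total 0ℚ p
... | inj₁ 0≤p = ℚ.≤-reflexive (sym (ℚ.0≤p⇒∣p∣≡p 0≤p))
... | inj₂ p≤0 = ℚ.≤-trans p≤0 (ℚ.0≤∣p∣ p)

p≤q⇒0≤q-p : ∀ {p q} → p ℚ.≤ q → 0ℚ ℚ.≤ q ℚ.- p
p≤q⇒0≤q-p {p} {q} p≤q = subst (ℚ._≤ q ℚ.- p) (ℚ.+-inverseʳ p) (ℚ.+-monoˡ-≤ (ℚ.- p) p≤q)

0≤q-p⇒p≤q : ∀ {p q} → 0ℚ ℚ.≤ q ℚ.- p → p ℚ.≤ q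
0≤q-p⇒p≤q {p} {q} 0≤q-p = subst₂ ℚ._≤_ (ℚ.+-identityˡ p)
  (solve 2 (λ p q → q :- p :+ p := q) refl p q) (ℚ.+-monoˡ-≤ p 0≤q-p)
  where open +-*-Solver

eventually-× : ∀ {A B : ℕ → Set} → Eventually A → Eventually B → Eventually (λ n → A n × B n)
eventually-× (M , a) (N , b) = M ℕ.⊔ N , λ n p →
  a n (ℕ.m⊔n≤o⇒m≤o M N p) , b n (ℕ.m⊔n≤o⇒n≤o M N p)

eventually-map : ∀ {A B : ℕ → Set} → (∀ n → A n → B n) → Eventually A → Eventually B
eventually-map f (N , a) = N , λ n p → f n (a n p)

IsNull : (ℕ → ℚ) → Set
IsNull f = ∀ ε → 0ℚ ℚ.< ε → Eventually (λ n → ∣ f n ∣ ℚ.< ε)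

null-cong : ∀ {f g} → (∀ n → f n ≡ g n) → IsNull f → IsNull g
null-cong f≗g null ε 0<ε = eventually-map (λ n → subst (λ q → ∣ q ∣ ℚ.< ε) (f≗g n)) (null ε 0<ε)

null-+ : ∀ {f g} → IsNull f → IsNull g → IsNull (λ n → f n ℚ.+ g n)
null-+ {f} {g} nf ng ε 0<ε with halve 0<ε
... | δ , 0<δ , eq = eventually-map
  (λ n (p , q) → ℚ.≤-<-trans (ℚ.∣p+q∣≤∣p∣+∣q∣ (f n) (g n))
    (subst (∣ f n ∣ ℚ.+ ∣ g n ∣ ℚ.<_) eq (ℚ.+-mono-< p q)))
  (eventually-× (nf δ 0<δ) (ng δ 0<δ))

null-neg : ∀ {f} → IsNull f → IsNull (λ n → ℚ.- f n)
null-neg {f} nf ε 0<ε =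
  eventually-map (λ n → subst (ℚ._< ε) (sym (ℚ.∣-p∣≡∣p∣ (f n)))) (nf ε 0<ε)

bounded : ∀ x → Σ[ B ∈ ℚ ] 0ℚ ℚ.< B × Eventually (λ n → ∣ seq x n ∣ ℚ.≤ B)
bounded x with isCauchy x 1ℚ (ℚ.positive⁻¹ 1ℚ)
... | N , close = 1ℚ ℚ.+ ∣ seq x N ∣ , ℚ.+-mono-<-≤ (ℚ.positive⁻¹ 1ℚ) (ℚ.0≤∣p∣ (seq x N)) ,
  N , λ n N≤n → begin
    ∣ seq x n ∣                              ≡⟨ cong ∣_∣ (solve 2 (λ a b → a := a :- b :+ b) refl (seq x n) (seq x N)) ⟩
    ∣ (seq x n ℚ.- seq x N) ℚ.+ seq x N ∣    ≤⟨ ℚ.∣p+q∣≤∣p∣+∣q∣ (seq x n ℚ.- seq x N) (seq x N) ⟩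
    ∣ seq x n ℚ.- seq x N ∣ ℚ.+ ∣ seq x N ∣  ≤⟨ ℚ.+-monoˡ-≤ ∣ seq x N ∣ (ℚ.<⇒≤ (close n N N≤n ℕ.≤-refl)) ⟩
    1ℚ ℚ.+ ∣ seq x N ∣                       ∎
  where
  open ℚ.≤-Reasoning
  open +-*-Solver

1/_⟨_⟩ : ∀ p → 0ℚ ℚ.< p → ℚ
1/ p ⟨ 0<p ⟩ = ℚ.1/_ p {{ℚ.pos⇒nonZero p {{ℚ.positive 0<p}}}}

1/-pos : ∀ p (0<p : 0ℚ ℚ.< p) → 0ℚ ℚ.< 1/ p ⟨ 0<p ⟩
1/-pos p 0<p = ℚ.positive⁻¹ 1/ p ⟨ 0<p ⟩ {{ℚ.1/pos⇒pos p {{ℚ.positive 0<p}}}}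

1/-inverse : ∀ p (0<p : 0ℚ ℚ.< p) → p ℚ.* 1/ p ⟨ 0<p ⟩ ≡ 1ℚ
1/-inverse p 0<p = ℚ.*-inverseʳ p {{ℚ.pos⇒nonZero p {{ℚ.positive 0<p}}}}

*-pos : ∀ {p q} → 0ℚ ℚ.< p → 0ℚ ℚ.< q → 0ℚ ℚ.< p ℚ.* q
*-pos {p} {q} 0<p 0<q =
  subst (ℚ._< p ℚ.* q) (ℚ.*-zeroʳ p) (ℚ.*-monoʳ-<-pos p {{ℚ.positive 0<p}} 0<q)

divide : ∀ {D ε} → 0ℚ ℚ.< D → 0ℚ ℚ.< ε → Σ[ δ ∈ ℚ ] 0ℚ ℚ.< δ × D ℚ.* δ ≡ ε
divide {D} {ε} 0<D 0<ε = 1/ D ⟨ 0<D ⟩ ℚ.* ε , *-pos (1/-pos D 0<D) 0<ε ,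
  trans (sym (ℚ.*-assoc D _ ε)) (trans (cong (ℚ._* ε) (1/-inverse D 0<D)) (ℚ.*-identityˡ ε))

*-bound : ∀ {p q B δ} → 0ℚ ℚ.< B → ∣ p ∣ ℚ.≤ B → ∣ q ∣ ℚ.< δ → ∣ p ℚ.* q ∣ ℚ.< B ℚ.* δ
*-bound {p} {q} {B} {δ} 0<B p≤B q<δ = begin-strict
  ∣ p ℚ.* q ∣      ≡⟨ ℚ.∣p*q∣≡∣p∣*∣q∣ p q ⟩
  ∣ p ∣ ℚ.* ∣ q ∣  ≤⟨ ℚ.*-monoʳ-≤-nonNeg ∣ q ∣ {{ℚ.∣-∣-nonNeg q}} p≤B ⟩
  B ℚ.* ∣ q ∣      <⟨ ℚ.*-monoʳ-<-pos B {{ℚ.positive 0<B}} q<δ ⟩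
  B ℚ.* δ          ∎
  where open ℚ.≤-Reasoning

null-* : ∀ x {f} → IsNull f → IsNull (λ n → seq x n ℚ.* f n)
null-* x {f} nf ε 0<ε =
  let B , 0<B , ev = bounded x
      δ , 0<δ , eq = divide 0<B 0<ε
  in eventually-map
    (λ n (a , b) → subst (∣ seq x n ℚ.* f n ∣ ℚ.<_) eq (*-bound {seq x n} {f n} 0<B a b))
    (eventually-× ev (nf δ 0<δ))

≗⇒≈ : ∀ {x y} → (∀ n → seq x n ≡ seq y n) → x ≈ y
≗⇒≈ {x} {y} x≗y = mk≈ λ ε 0<ε → 0 , λ n _ → subst (λ q → ∣ q ∣ ℚ.< ε)
  (sym (trans (cong (ℚ._- seq y n) (x≗y n)) (ℚ.+-inverseʳ (seq y n)))) 0<ε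

≈-trans : ∀ {x y z} → x ≈ y → y ≈ z → x ≈ z
≈-trans {x} {y} {z} (mk≈ p) (mk≈ q) = mk≈ (null-cong
  (λ n → solve 3 (λ a b c → (a :- b) :+ (b :- c) := a :- c) refl (seq x n) (seq y n) (seq z n))
  (null-+ p q))
  where open +-*-Solver

≈-sym : ∀ {x y} → x ≈ y → y ≈ x
≈-sym {x} {y} (mk≈ p) = mk≈ (null-cong
  (λ n → solve 2 (λ a b → :- (a :- b) := b :- a) refl (seq x n) (seq y n))
  (null-neg p))
  where open +-*-Solver

+-cong : ∀ {x x′ y y′} → x ≈ x′ → y ≈ y′ → x + y ≈ x′ + y′
+-cong {x} {x′} {y} {y′} (mk≈ p) (mk≈ q) = mk≈ (null-cong
  (λ n → solve 4 (λ a b c d → (a :- b) :+ (c :- d) := (a :+ c) :- (b :+ d)) refl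
    (seq x n) (seq x′ n) (seq y n) (seq y′ n))
  (null-+ p q))
  where open +-*-Solver

*-cong : ∀ {x x′ y y′} → x ≈ x′ → y ≈ y′ → x * y ≈ x′ * y′
*-cong {x} {x′} {y} {y′} (mk≈ p) (mk≈ q) = mk≈ (null-cong
  (λ n → solve 4 (λ a b c d → (d :* (a :- b)) :+ (a :* (c :- d)) := (a :* c) :- (b :* d)) refl
    (seq x n) (seq x′ n) (seq y n) (seq y′ n))
  (null-+ (null-* y′ p) (null-* x q)))
  where open +-*-Solver

-‿cong : ∀ {x y} → x ≈ y → - x ≈ - y
-‿cong {x} {y} (mk≈ p) = mk≈ (null-cong
  (λ n → solve 2 (λ a b → :- (a :- b) := (:- a) :- (:- b)) refl (seq x n) (seq y n))
  (null-neg p))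
  where open +-*-Solver

ℝ-commutativeRing : CommutativeRing _ _
ℝ-commutativeRing = record
  { Carrier = ℝ ; _≈_ = _≈_ ; _+_ = _+_ ; _*_ = _*_ ; -_ = -_ ; 0# = 0ℝ ; 1# = 1ℝ
  ; isCommutativeRing = record
    { isRing = record
      { +-isAbelianGroup = record
        { isGroup = record
          { isMonoid = record
            { isSemigroup = record
              { isMagma = record
                { isEquivalence = record
                  { refl = ≗⇒≈ λ _ → refl ; sym = ≈-sym ; trans = ≈-trans }
                ; ∙-cong = +-cong
                }
              ; assoc = λ x y z → ≗⇒≈ λ n → ℚ.+-assoc (seq x n) (seq y n) (seq z n)
              }
            ; identity = (λ x → ≗⇒≈ λ n → ℚ.+-identityˡ (seq x n))
                       , (λ x → ≗⇒≈ λ n → ℚ.+-identityʳ (seq x n))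
            }
          ; inverse = (λ x → ≗⇒≈ λ n → ℚ.+-inverseˡ (seq x n))
                    , (λ x → ≗⇒≈ λ n → ℚ.+-inverseʳ (seq x n))
          ; ⁻¹-cong = -‿cong
          }
        ; comm = λ x y → ≗⇒≈ λ n → ℚ.+-comm (seq x n) (seq y n)
        }
      ; *-cong = *-cong
      ; *-assoc = λ x y z → ≗⇒≈ λ n → ℚ.*-assoc (seq x n) (seq y n) (seq z n)
      ; *-identity = (λ x → ≗⇒≈ λ n → ℚ.*-identityˡ (seq x n))
                   , (λ x → ≗⇒≈ λ n → ℚ.*-identityʳ (seq x n))
      ; distrib = (λ x y z → ≗⇒≈ λ n → ℚ.*-distribˡ-+ (seq x n) (seq y n) (seq z n))
                , (λ x y z → ≗⇒≈ λ n → ℚ.*-distribʳ-+ (seq x n) (seq y n) (seq z n))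
      }
    ; *-comm = λ x y → ≗⇒≈ λ n → ℚ.*-comm (seq x n) (seq y n)
    }
  }

open CommutativeRing ℝ-commutativeRing using (semiring) renaming (refl to ≈-refl)
open import Algebra.Properties.Semiring.Sum semiring using (sum-cong-≋)

-- Rational coefficients let the solver cancel halves and compare constants, which
-- would be impossible with the undecidable equality of ℝ.
fromℚ-homomorphism : CommutativeRing.rawRing ℚ.+-*-commutativeRing
  -Raw-AlmostCommutative⟶ fromCommutativeRing ℝ-commutativeRing
fromℚ-homomorphism = record
  { ⟦_⟧ = fromℚ
  ; +-homo = λ _ _ → ≗⇒≈ λ _ → refl
  ; *-homo = λ _ _ → ≗⇒≈ λ _ → refl
  ; -‿homo = λ _ → ≗⇒≈ λ _ → refl
  ; 0-homo = ≗⇒≈ λ _ → refl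
  ; 1-homo = ≗⇒≈ λ _ → refl
  }

fromℚ-≟ : ∀ p q → Maybe (fromℚ p ≈ fromℚ q)
fromℚ-≟ p q with p ℚ.≟ q
... | yes refl = just (≗⇒≈ λ _ → refl)
... | no _     = nothing

module ℝ-Solver = RingSolver (CommutativeRing.rawRing ℚ.+-*-commutativeRing)
  (fromCommutativeRing ℝ-commutativeRing) fromℚ-homomorphism fromℚ-≟

-- The strict order on the reals

Positive : ℝ → Set
Positive x = Σ[ g ∈ ℚ ] 0ℚ ℚ.< g × Eventually (λ n → g ℚ.≤ seq x n)

0<⇒positive : ∀ {x} → 0ℝ < x → Positive x
0<⇒positive {x} (mk< g 0<g ev) =
  g , 0<g , eventually-map (λ n → subst (ℚ._≤ seq x n) (ℚ.+-identityˡ g)) ev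

positive⇒0< : ∀ {x} → Positive x → 0ℝ < x
positive⇒0< {x} (g , 0<g , ev) =
  mk< g 0<g (eventually-map (λ n → subst (ℚ._≤ seq x n) (sym (ℚ.+-identityˡ g))) ev)

<⇒0< : ∀ {x y} → x < y → 0ℝ < y - x
<⇒0< {x} {y} (mk< g 0<g ev) = positive⇒0< (g , 0<g , eventually-map
  (λ n p → subst (ℚ._≤ seq y n ℚ.- seq x n)
    (solve 2 (λ a g → a :+ g :- a := g) refl (seq x n) g) (ℚ.+-monoˡ-≤ (ℚ.- seq x n) p)) ev)
  where open +-*-Solver

0<⇒< : ∀ {x y} → 0ℝ < y - x → x < y
0<⇒< {x} {y} 0<y-x with 0<⇒positive 0<y-x
... | g , 0<g , ev = mk< g 0<g (eventually-map
  (λ n p → subst (seq x n ℚ.+ g ℚ.≤_)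
    (solve 2 (λ a b → a :+ (b :- a) := b) refl (seq x n) (seq y n)) (ℚ.+-monoʳ-≤ (seq x n) p)) ev)
  where open +-*-Solver

∣p-q∣<δ⇒g-δ≤q : ∀ {p q g δ} → g ℚ.≤ p → ∣ p ℚ.- q ∣ ℚ.< δ → g ℚ.- δ ℚ.≤ q
∣p-q∣<δ⇒g-δ≤q {p} {q} {g} {δ} g≤p close = begin
  g ℚ.- δ          ≤⟨ ℚ.+-mono-≤ g≤p (ℚ.neg-antimono-≤ (ℚ.≤-trans (p≤∣p∣ (p ℚ.- q)) (ℚ.<⇒≤ close))) ⟩
  p ℚ.- (p ℚ.- q)  ≡⟨ solve 2 (λ p q → p :- (p :- q) := q) refl p q ⟩
  q                ∎
  where
  open ℚ.≤-Reasoning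
  open +-*-Solver

halve-- : ∀ {ε δ} → δ ℚ.+ δ ≡ ε → ε ℚ.- δ ≡ δ
halve-- {ε} {δ} refl = solve 1 (λ d → d :+ d :- d := d) refl δ
  where open +-*-Solver

neg-involutive : ∀ p → ℚ.- (ℚ.- p) ≡ p
neg-involutive p = solve 1 (λ p → :- (:- p) := p) refl p
  where open +-*-Solver

0<-resp-≈ : ∀ {x y} → x ≈ y → 0ℝ < x → 0ℝ < y
0<-resp-≈ {x} {y} (mk≈ x≈y) 0<x =
  let g , 0<g , ev = 0<⇒positive 0<x
      δ , 0<δ , eq = halve 0<g
  in positive⇒0< (δ , 0<δ , eventually-map
    (λ n (a , b) → subst (ℚ._≤ seq y n) (halve-- eq) (∣p-q∣<δ⇒g-δ≤q {seq x n} {seq y n} {g} {δ} a b))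
    (eventually-× ev (x≈y δ 0<δ)))

0<-+ : ∀ {x y} → 0ℝ < x → 0ℝ < y → 0ℝ < x + y
0<-+ 0<x 0<y =
  let g , 0<g , ev = 0<⇒positive 0<x
      h , 0<h , ev′ = 0<⇒positive 0<y
  in positive⇒0< (g ℚ.+ h , ℚ.+-mono-< 0<g 0<h ,
       eventually-map (λ n (a , b) → ℚ.+-mono-≤ a b) (eventually-× ev ev′))

*-mono-≤-pos : ∀ {g h p q} → 0ℚ ℚ.< g → 0ℚ ℚ.< h → g ℚ.≤ p → h ℚ.≤ q → g ℚ.* h ℚ.≤ p ℚ.* q
*-mono-≤-pos {g} {h} {p} {q} 0<g 0<h g≤p h≤q = ℚ.≤-trans
  (ℚ.*-monoˡ-≤-nonNeg g {{ℚ.pos⇒nonNeg g {{ℚ.positive 0<g}}}} h≤q)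
  (ℚ.*-monoʳ-≤-nonNeg q {{ℚ.pos⇒nonNeg q {{ℚ.positive (ℚ.<-≤-trans 0<h h≤q)}}}} g≤p)

0<-* : ∀ {x y} → 0ℝ < x → 0ℝ < y → 0ℝ < x * y
0<-* {x} {y} 0<x 0<y =
  let g , 0<g , ev = 0<⇒positive 0<x
      h , 0<h , ev′ = 0<⇒positive 0<y
  in positive⇒0< (g ℚ.* h , *-pos 0<g 0<h ,
       eventually-map (λ n (a , b) → *-mono-≤-pos {p = seq x n} {seq y n} 0<g 0<h a b)
         (eventually-× ev ev′))

0<fromℚ : ∀ {q} → 0ℚ ℚ.< q → 0ℝ < fromℚ q
0<fromℚ {q} 0<q = positive⇒0< (q , 0<q , 0 , λ _ _ → ℚ.≤-refl)

0≮0 : ¬ (0ℝ < 0ℝ)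
0≮0 0<0 =
  let g , 0<g , N , ev = 0<⇒positive 0<0
  in ℚ.<-irrefl refl (ℚ.<-≤-trans 0<g (ev N ℕ.≤-refl))

-- Beyond `N` the sequence moves by less than δ, half of ε, so a single term of size ε keeps all
-- later terms above δ.
late-term⇒0< : ∀ x {ε δ N} → 0ℚ ℚ.< δ → δ ℚ.+ δ ≡ ε →
  (∀ m n → N ℕ.≤ m → N ℕ.≤ n → ∣ seq x m ℚ.- seq x n ∣ ℚ.< δ) →
  ε ℚ.≤ seq x N → 0ℝ < x
late-term⇒0< x {ε} {δ} {N} 0<δ eq close ε≤x = positive⇒0< (δ , 0<δ , N , λ n N≤n →
  subst (ℚ._≤ seq x n) (halve-- eq)
    (∣p-q∣<δ⇒g-δ≤q {seq x N} {seq x n} {ε} {δ} ε≤x (close N n ℕ.≤-refl N≤n)))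

-- Here a negative hypothesis yields an explicit index. The Cauchy modulus provides it: any later
-- term of size at least ε would make `x` positive, and comparison of rationals is decidable.
≯0⇒eventually< : ∀ {x} → ¬ (0ℝ < x) → ∀ ε → 0ℚ ℚ.< ε → Eventually (λ n → seq x n ℚ.< ε)
≯0⇒eventually< {x} ¬0<x ε 0<ε =
  let δ , 0<δ , eq = halve 0<ε
      N , close = isCauchy x δ 0<δ
  in N , λ n N≤n → ℚ.≰⇒> λ ε≤xn → ¬0<x (late-term⇒0< x {ε} {δ} {n} 0<δ eq
    (λ m m′ n≤m n≤m′ → close m m′ (ℕ.≤-trans N≤n n≤m) (ℕ.≤-trans N≤n n≤m′)) ε≤xn)

∣p∣<-intro : ∀ {p ε} → p ℚ.< ε → ℚ.- p ℚ.< ε → ∣ p ∣ ℚ.< ε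
∣p∣<-intro {p} p<ε -p<ε with ℚ.∣p∣≡p∨∣p∣≡-p p
... | inj₁ eq = subst (ℚ._< _) (sym eq) p<ε
... | inj₂ eq = subst (ℚ._< _) (sym eq) -p<ε

-- An equality obtained from two negations: the source of the stability of `≈`, of antisymmetry and
-- of trichotomy under ¬ ¬.
≯0∧≮0⇒≈0 : ∀ {x} → ¬ (0ℝ < x) → ¬ (0ℝ < - x) → x ≈ 0ℝ
≯0∧≮0⇒≈0 {x} ¬0<x ¬0<-x = mk≈ λ ε 0<ε → eventually-map
  (λ n (a , b) → subst (λ q → ∣ q ∣ ℚ.< ε) (sym (ℚ.+-identityʳ (seq x n))) (∣p∣<-intro {seq x n} a b))
  (eventually-× (≯0⇒eventually< {x} ¬0<x ε 0<ε) (≯0⇒eventually< { - x} ¬0<-x ε 0<ε))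

-- Reciprocals of positive reals

1/-diff : ∀ a b (0<a : 0ℚ ℚ.< a) (0<b : 0ℚ ℚ.< b) →
  1/ a ⟨ 0<a ⟩ ℚ.- 1/ b ⟨ 0<b ⟩ ≡ 1/ a ⟨ 0<a ⟩ ℚ.* 1/ b ⟨ 0<b ⟩ ℚ.* (b ℚ.- a)
1/-diff a b 0<a 0<b = lemma a b (1/ a ⟨ 0<a ⟩) (1/ b ⟨ 0<b ⟩) (1/-inverse a 0<a) (1/-inverse b 0<b)
  where
  open +-*-Solver
  lemma : ∀ a b a⁻¹ b⁻¹ → a ℚ.* a⁻¹ ≡ 1ℚ → b ℚ.* b⁻¹ ≡ 1ℚ → a⁻¹ ℚ.- b⁻¹ ≡ a⁻¹ ℚ.* b⁻¹ ℚ.* (b ℚ.- a)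
  lemma a b a⁻¹ b⁻¹ p q = trans
    (trans (solve 2 (λ x y → x :- y := x :* con 1ℚ :- y :* con 1ℚ) refl a⁻¹ b⁻¹)
      (cong₂ (λ s t → a⁻¹ ℚ.* s ℚ.- b⁻¹ ℚ.* t) (sym q) (sym p)))
    (solve 4 (λ a b x y → x :* (b :* y) :- y :* (a :* x) := x :* y :* (b :- a)) refl a b a⁻¹ b⁻¹)

0≤-*ℚ : ∀ {p q} → 0ℚ ℚ.< p → 0ℚ ℚ.≤ q → 0ℚ ℚ.≤ p ℚ.* q
0≤-*ℚ {p} {q} 0<p 0≤q = subst (ℚ._≤ p ℚ.* q) (ℚ.*-zeroʳ p)
  (ℚ.*-monoˡ-≤-nonNeg p {{ℚ.nonNegative (ℚ.<⇒≤ 0<p)}} 0≤q)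

1/-antimono : ∀ {a g} (0<a : 0ℚ ℚ.< a) (0<g : 0ℚ ℚ.< g) → g ℚ.≤ a → 1/ a ⟨ 0<a ⟩ ℚ.≤ 1/ g ⟨ 0<g ⟩
1/-antimono {a} {g} 0<a 0<g g≤a = 0≤q-p⇒p≤q (subst (0ℚ ℚ.≤_) (sym (1/-diff g a 0<g 0<a))
  (0≤-*ℚ {1/ g ⟨ 0<g ⟩ ℚ.* 1/ a ⟨ 0<a ⟩} {a ℚ.- g}
    (*-pos (1/-pos g 0<g) (1/-pos a 0<a)) (p≤q⇒0≤q-p g≤a)))

-- Terms before `N` may vanish, so the sequence is read at `N ⊔ n`, where every term is at least
-- `g`. All reciprocals are then at most `G`, and `1/-diff` bounds their differences by `G * G`
-- times those of `x`.
module Reciprocal (x : ℝ) (g : ℚ) (0<g : 0ℚ ℚ.< g) (N : ℕ) (g≤x : ∀ n → N ℕ.≤ n → g ℚ.≤ seq x n) where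

  N≤ : ∀ n → N ℕ.≤ N ℕ.⊔ n
  N≤ = ℕ.m≤m⊔n N
  x′ : ℕ → ℚ
  x′ n = seq x (N ℕ.⊔ n)
  0<x′ : ∀ n → 0ℚ ℚ.< x′ n
  0<x′ n = ℚ.<-≤-trans 0<g (g≤x (N ℕ.⊔ n) (N≤ n))
  y′ : ℕ → ℚ
  y′ n = 1/ x′ n ⟨ 0<x′ n ⟩
  G : ℚ
  G = 1/ g ⟨ 0<g ⟩
  0<G : 0ℚ ℚ.< G
  0<G = 1/-pos g 0<g
  y′≤G : ∀ n → y′ n ℚ.≤ G
  y′≤G n = 1/-antimono (0<x′ n) 0<g (g≤x (N ℕ.⊔ n) (N≤ n))
  0<y′ : ∀ n → 0ℚ ℚ.< y′ n
  0<y′ n = 1/-pos (x′ n) (0<x′ n)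
  y′y′≤GG : ∀ m n → ∣ y′ m ℚ.* y′ n ∣ ℚ.≤ G ℚ.* G
  y′y′≤GG m n = subst (ℚ._≤ G ℚ.* G) (sym (ℚ.0≤p⇒∣p∣≡p (ℚ.<⇒≤ (*-pos (0<y′ m) (0<y′ n)))))
    (*-mono-≤-pos {y′ m} {y′ n} {G} {G} (0<y′ m) (0<y′ n) (y′≤G m) (y′≤G n))
  cauchy : IsCauchy y′
  cauchy ε 0<ε =
    let δ , 0<δ , eq = divide (*-pos 0<G 0<G) 0<ε
        K , close = isCauchy x δ 0<δ
        le : ∀ {n} → K ℕ.≤ n → K ℕ.≤ N ℕ.⊔ n
        le K≤n = ℕ.≤-trans K≤n (ℕ.m≤n⊔m N _)
    in K , λ m n p q → subst₂ ℚ._<_ (cong ∣_∣ (sym (1/-diff (x′ m) (x′ n) (0<x′ m) (0<x′ n)))) eq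
      (*-bound {y′ m ℚ.* y′ n} {x′ n ℚ.- x′ m} (*-pos 0<G 0<G) (y′y′≤GG m n)
        (close (N ℕ.⊔ n) (N ℕ.⊔ m) (le q) (le p)))
  y : ℝ
  y = mkℝ y′ cauchy
  0<y : 0ℝ < y
  0<y =
    let B , 0<B , M , x≤B = bounded x
    in positive⇒0< (1/ B ⟨ 0<B ⟩ , 1/-pos B 0<B , M , λ n M≤n →
      1/-antimono 0<B (0<x′ n) (ℚ.≤-trans (p≤∣p∣ (x′ n))
        (x≤B (N ℕ.⊔ n) (ℕ.≤-trans M≤n (ℕ.m≤n⊔m N n)))))
  xy≈1 : x * y ≈ 1ℝ
  -- From index `N` on, `N ⊔ n` is `n` itself, so the products of terms are exactly one.
  xy≈1 = mk≈ λ ε 0<ε → N , λ n N≤n →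
    let eq = trans (cong (λ k → seq x k ℚ.* y′ n) (sym (ℕ.m≤n⇒m⊔n≡n N≤n))) (1/-inverse (x′ n) (0<x′ n))
    in subst (λ q → ∣ q ∣ ℚ.< ε) (sym (trans (cong (ℚ._- 1ℚ) eq) (ℚ.+-inverseʳ 1ℚ))) 0<ε

inverse : ∀ {x} → 0ℝ < x → Σ[ y ∈ ℝ ] 0ℝ < y × x * y ≈ 1ℝ
inverse {x} 0<x =
  let g , 0<g , N , g≤x = 0<⇒positive 0<x
      open Reciprocal x g 0<g N g≤x
  in y , 0<y , xy≈1

-- Natural numbers and the Archimedean property

ι : ℕ → ℝ
ι zero    = 0ℝ
ι (suc n) = 1ℝ + ι n

ιℚ : ℕ → ℚ
ιℚ zero    = 0ℚ
ιℚ (suc n) = 1ℚ ℚ.+ ιℚ n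

seq-ι : ∀ N n → seq (ι N) n ≡ ιℚ N
seq-ι zero    n = refl
seq-ι (suc N) n = cong (1ℚ ℚ.+_) (seq-ι N n)

toℚᵘ-ιℚ : ∀ N → ℚ.toℚᵘ (ιℚ N) ℚᵘ.≃ ℚᵘ.mkℚᵘ (ℤ.+ N) 0
toℚᵘ-ιℚ zero    = ℚᵘ.≃-refl
toℚᵘ-ιℚ (suc N) = ℚᵘ.≃-trans (ℚ.toℚᵘ-homo-+ 1ℚ (ιℚ N)) (ℚᵘ.≃-trans
  (ℚᵘ.+-congʳ ℚᵘ.1ℚᵘ (toℚᵘ-ιℚ N)) (ℚᵘ.*≡* (cong (ℤ._* ℤ.1ℤ)
    (cong₂ ℤ._+_ {x = ℤ.1ℤ} refl (ℤ.*-identityʳ (ℤ.+ N))))))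

-- The denominator is at least one, so the absolute value of the numerator is already a bound.
≤ιℚ : ∀ p → p ℚ.≤ ιℚ ℤ.∣ ℚ.↥ p ∣
≤ιℚ p@(mkℚ _ _ _) = ℚ.toℚᵘ-cancel-≤ (ℚᵘ.≤-respʳ-≃ (ℚᵘ.≃-sym (toℚᵘ-ιℚ N)) (ℚᵘ.*≤* (begin
  ℚ.↥ p ℤ.* ℤ.1ℤ        ≡⟨ ℤ.*-identityʳ (ℚ.↥ p) ⟩
  ℚ.↥ p                 ≤⟨ i≤∣i∣ (ℚ.↥ p) ⟩
  ℤ.+ N                 ≤⟨ ℤ.+≤+ (ℕ.m≤m*n N (ℚ.↧ₙ p)) ⟩
  ℤ.+ (N ℕ.* ℚ.↧ₙ p)    ≡⟨ ℤ.pos-* N (ℚ.↧ₙ p) ⟩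
  ℤ.+ N ℤ.* ℚ.↧ p       ∎)))
  where
  open ℤ.≤-Reasoning
  N = ℤ.∣ ℚ.↥ p ∣
  i≤∣i∣ : ∀ i → i ℤ.≤ ℤ.+ ℤ.∣ i ∣
  i≤∣i∣ (ℤ.+ n)    = ℤ.≤-refl
  i≤∣i∣ ℤ.-[1+ n ] = ℤ.-≤+

≤ι⇒+1≤ι : ∀ {p B} N n → ∣ p ∣ ℚ.≤ B → B ℚ.≤ ιℚ N → p ℚ.+ 1ℚ ℚ.≤ seq (ι (suc N)) n
≤ι⇒+1≤ι {p} {B} N n p≤B B≤N = subst (p ℚ.+ 1ℚ ℚ.≤_) (sym (seq-ι (suc N) n))
  (subst (p ℚ.+ 1ℚ ℚ.≤_) (ℚ.+-comm (ιℚ N) 1ℚ)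
    (ℚ.+-monoˡ-≤ 1ℚ (ℚ.≤-trans (p≤∣p∣ p) (ℚ.≤-trans p≤B B≤N))))

archimedean : ∀ x → ∃[ N ] x < ι N
archimedean x =
  let B , 0<B , M , x≤B = bounded x
      N = ℤ.∣ ℚ.↥ B ∣
  -- The successor provides the gap of one that a strict inequality must exhibit.
  in suc N , mk< 1ℚ (ℚ.positive⁻¹ 1ℚ) (M , λ n M≤n → ≤ι⇒+1≤ι {seq x n} {B} N n (x≤B n M≤n) (≤ιℚ B))

-- Order laws and case distinctions under ¬ ¬

open ℝ-Solver using (solve; _:=_; _:+_; _:*_; _:-_; :-_; con)

0<1 : 0ℝ < 1ℝ
0<1 = 0<fromℚ (ℚ.positive⁻¹ 1ℚ)

0≤⇒≮0 : ∀ {x} → 0ℝ ≤ x → ¬ (0ℝ < - x)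
0≤⇒≮0 {x} 0≤x 0<-x = 0≤x (0<⇒< (0<-resp-≈ (solve 1 (λ x → :- x := con 0ℚ :- x) ≈-refl x) 0<-x))

≮0⇒0≤ : ∀ {x} → ¬ (0ℝ < - x) → 0ℝ ≤ x
≮0⇒0≤ {x} ¬0<-x x<0 =
  ¬0<-x (0<-resp-≈ (solve 1 (λ x → con 0ℚ :- x := :- x) ≈-refl x) (<⇒0< x<0))

-- Terms of `y` may be negative, but they eventually exceed every negative rational; allowing them
-- to reach minus half the gap of `x` leaves the other half.
0<-+-0≤ : ∀ {x y} → 0ℝ < x → 0ℝ ≤ y → 0ℝ < x + y
0<-+-0≤ {x} {y} 0<x 0≤y =
  let g , 0<g , ev = 0<⇒positive 0<x
      δ , 0<δ , eq = halve 0<g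
  in positive⇒0< (δ , 0<δ , eventually-map
    (λ n (a , b) → subst₂ ℚ._≤_ (halve-- eq) (cong (seq x n ℚ.+_) (neg-involutive (seq y n)))
      (ℚ.+-mono-≤ a (ℚ.neg-antimono-≤ (ℚ.<⇒≤ b))))
    (eventually-× ev (≯0⇒eventually< { - y} (0≤⇒≮0 0≤y) δ 0<δ)))

0<⇒0≤ : ∀ {x} → 0ℝ < x → 0ℝ ≤ x
0<⇒0≤ {x} 0<x = ≮0⇒0≤ λ 0<-x → 0≮0
  (0<-resp-≈ (solve 1 (λ x → x :- x := con 0ℚ) ≈-refl x) (0<-+ 0<x 0<-x))

0≤-resp-≈ : ∀ {x y} → x ≈ y → 0ℝ ≤ x → 0ℝ ≤ y
0≤-resp-≈ x≈y 0≤x = ≮0⇒0≤ λ 0<-y → 0≤⇒≮0 0≤x (0<-resp-≈ (-‿cong (≈-sym x≈y)) 0<-y)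

0≤0 : 0ℝ ≤ 0ℝ
0≤0 = 0≮0

≈0⇒0≤ : ∀ {x} → x ≈ 0ℝ → 0ℝ ≤ x
≈0⇒0≤ x≈0 = 0≤-resp-≈ (≈-sym x≈0) 0≤0

0≤∧<⇒⊥ : ∀ {x y} → 0ℝ < x → 0ℝ ≤ y → ¬ (x + y ≈ 0ℝ)
0≤∧<⇒⊥ 0<x 0≤y x+y≈0 = 0≮0 (0<-resp-≈ x+y≈0 (0<-+-0≤ 0<x 0≤y))

sign : ∀ x → ¬ ¬ (0ℝ < x ⊎ x ≈ 0ℝ ⊎ 0ℝ < - x)
sign x k = k (inj₂ (inj₁ (≯0∧≮0⇒≈0 (k ∘ inj₁) (k ∘ inj₂ ∘ inj₂))))

0≤-cases : ∀ {x} → 0ℝ ≤ x → ¬ ¬ (0ℝ < x ⊎ x ≈ 0ℝ)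
0≤-cases {x} 0≤x k = k (inj₂ (≯0∧≮0⇒≈0 (k ∘ inj₁) (0≤⇒≮0 0≤x)))

0≤-+ : ∀ {x y} → 0ℝ ≤ x → 0ℝ ≤ y → 0ℝ ≤ x + y
0≤-+ {x} {y} 0≤x 0≤y = ≮0⇒0≤ λ 0<-[x+y] → 0≤∧<⇒⊥ (0<-+-0≤ 0<-[x+y] 0≤x) 0≤y
  (solve 2 (λ x y → :- (x :+ y) :+ x :+ y := con 0ℚ) ≈-refl x y)

0≤-* : ∀ {x y} → 0ℝ ≤ x → 0ℝ ≤ y → 0ℝ ≤ x * y
0≤-* {x} {y} 0≤x 0≤y xy<0 = 0≤-cases 0≤x λ where
  (inj₁ 0<x) → 0≤-cases 0≤y λ where
    (inj₁ 0<y) → 0<⇒0≤ (0<-* 0<x 0<y) xy<0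
    (inj₂ y≈0) → ≈0⇒0≤ (≈-trans (*-cong (≈-refl {x}) y≈0) (solve 1 (λ x → x :* con 0ℚ := con 0ℚ) ≈-refl x)) xy<0
  (inj₂ x≈0) → ≈0⇒0≤ (≈-trans (*-cong x≈0 (≈-refl {y})) (solve 1 (λ y → con 0ℚ :* y := con 0ℚ) ≈-refl y)) xy<0

≤⇒0≤ : ∀ {x y} → x ≤ y → 0ℝ ≤ y - x
≤⇒0≤ {x} {y} x≤y = ≮0⇒0≤ λ 0<-[y-x] → x≤y (0<⇒<
  (0<-resp-≈ (solve 2 (λ x y → :- (y :- x) := x :- y) ≈-refl x y) 0<-[y-x]))

0≤⇒≤ : ∀ {x y} → 0ℝ ≤ y - x → x ≤ y
0≤⇒≤ {x} {y} 0≤y-x y<x = 0≤⇒≮0 0≤y-x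
  (0<-resp-≈ (solve 2 (λ x y → x :- y := :- (y :- x)) ≈-refl x y) (<⇒0< y<x))

-- Certificate style: `e` is assembled from quantities known to be nonnegative, and the remaining
-- identity goes to the ring solver. `≈-by` and `≈0-by` do the same with combinations of vanishing
-- quantities.
≤-by : ∀ {x y} e → 0ℝ ≤ e → e ≈ y - x → x ≤ y
≤-by _ 0≤e eq = 0≤⇒≤ (0≤-resp-≈ eq 0≤e)

≈-by : ∀ {x y e} → e ≈ 0ℝ → e ≈ y - x → x ≈ y
≈-by {x} {y} {e} e≈0 eq = ≈-trans (solve 2 (λ x y → x := y :- (y :- x)) ≈-refl x y)
  (≈-trans (+-cong ≈-refl (-‿cong (≈-trans (≈-sym eq) e≈0)))
    (solve 1 (λ y → y :- con 0ℚ := y) ≈-refl y))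

≈⇒-≈0 : ∀ {x y} → x ≈ y → x - y ≈ 0ℝ
≈⇒-≈0 {x} {y} x≈y =
  ≈-trans (+-cong x≈y ≈-refl) (solve 1 (λ y → y :- y := con 0ℚ) ≈-refl y)

<⇒≤ : ∀ {x y} → x < y → x ≤ y
<⇒≤ x<y = 0≤⇒≤ (0<⇒0≤ (<⇒0< x<y))

≈⇒≤ : ∀ {x y} → x ≈ y → x ≤ y
≈⇒≤ x≈y = 0≤⇒≤ (≈0⇒0≤ (≈⇒-≈0 (≈-sym x≈y)))

≤-trans : ∀ {x y z} → x ≤ y → y ≤ z → x ≤ z
≤-trans {x} {y} {z} x≤y y≤z = ≤-by _ (0≤-+ (≤⇒0≤ x≤y) (≤⇒0≤ y≤z))
  (solve 3 (λ x y z → (y :- x) :+ (z :- y) := z :- x) ≈-refl x y z)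

≤-antisym : ∀ {x y} → x ≤ y → y ≤ x → x ≈ y
≤-antisym {x} {y} x≤y y≤x = ≈-by
  (≯0∧≮0⇒≈0 (λ 0<y-x → y≤x (0<⇒< 0<y-x)) (0≤⇒≮0 (≤⇒0≤ x≤y))) ≈-refl

≤⊎< : ∀ x y → ¬ ¬ (x ≤ y ⊎ y < x)
≤⊎< x y k = k (inj₁ (k ∘ inj₂))

≈0-stable : ∀ {x} → ¬ ¬ (x ≈ 0ℝ) → x ≈ 0ℝ
≈0-stable {x} ¬¬x≈0 = ≯0∧≮0⇒≈0
  (λ 0<x → ¬¬x≈0 λ x≈0 → 0≮0 (0<-resp-≈ x≈0 0<x))
  (λ 0<-x → ¬¬x≈0 λ x≈0 → 0≮0 (0<-resp-≈ (≈-trans (-‿cong x≈0) (solve 0 (:- con 0ℚ := con 0ℚ) ≈-refl)) 0<-x))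

≉0⇒inverse : ∀ {x} → ¬ (x ≈ 0ℝ) → ¬ ¬ (Σ[ y ∈ ℝ ] x * y ≈ 1ℝ)
≉0⇒inverse {x} x≉0 k = sign x λ where
  (inj₁ 0<x)         → let y , _ , xy≈1 = inverse 0<x in k (y , xy≈1)
  (inj₂ (inj₁ x≈0))  → x≉0 x≈0
  (inj₂ (inj₂ 0<-x)) → let y , _ , -xy≈1 = inverse 0<-x in
    k (- y , ≈-trans (solve 2 (λ x y → x :* :- y := (:- x) :* y) ≈-refl x y) -xy≈1)

-- The conclusion is stable, so the reciprocal of `x`, which exists only under ¬ ¬, may be used to
-- cancel.
*≈0⇒≈0 : ∀ {x y} → x * y ≈ 0ℝ → ¬ (x ≈ 0ℝ) → y ≈ 0ℝ
*≈0⇒≈0 {x} {y} xy≈0 x≉0 = ≈0-stable λ y≉0 → ≉0⇒inverse x≉0 λ (z , xz≈1) → y≉0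
  (≈-trans (solve 1 (λ y → y := y :* con 1ℚ) ≈-refl y)
  (≈-trans (*-cong (≈-refl {y}) (≈-sym xz≈1))
  (≈-trans (solve 3 (λ x y z → y :* (x :* z) := x :* y :* z) ≈-refl x y z)
  (≈-trans (*-cong xy≈0 ≈-refl) (solve 1 (λ z → con 0ℚ :* z := con 0ℚ) ≈-refl z)))))

0≤ι : ∀ n → 0ℝ ≤ ι n
0≤ι zero    = 0≤0
0≤ι (suc n) = 0≤-+ (0<⇒0≤ 0<1) (0≤ι n)

-- Segments

*≈0 : ∀ c {x} → x ≈ 0ℝ → c * x ≈ 0ℝ
*≈0 c x≈0 = ≈-trans (*-cong (≈-refl {c}) x≈0) (solve 1 (λ c → c :* con 0ℚ := con 0ℚ) ≈-refl c)

+≈0 : ∀ {x y} → x ≈ 0ℝ → y ≈ 0ℝ → x + y ≈ 0ℝ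
+≈0 x≈0 y≈0 = ≈-trans (+-cong x≈0 y≈0) (solve 0 (con 0ℚ :+ con 0ℚ := con 0ℚ) ≈-refl)

≈0-by : ∀ {x e} → e ≈ 0ℝ → e ≈ x → x ≈ 0ℝ
≈0-by e≈0 e≈x = ≈-trans (≈-sym e≈x) e≈0

det : ℝ² → ℝ² → ℝ
det (x , y) (x′ , y′) = x * y′ - y * x′

∥⇒det≈0 : ∀ {p q} → p ∥ q → det p q ≈ 0ℝ
∥⇒det≈0 = ≈⇒-≈0

det≈0⇒∥ : ∀ {p q} → det p q ≈ 0ℝ → p ∥ q
det≈0⇒∥ {p} {q} det≈0 = ≈-sym (≈-by det≈0 ≈-refl)

det-sym≈0 : ∀ {p q} → det p q ≈ 0ℝ → det q p ≈ 0ℝ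
det-sym≈0 {px , py} {qx , qy} h = ≈0-by (*≈0 (- 1ℝ) h)
  (solve 4 (λ px py qx qy → (:- con 1ℚ) :* (px :* qy :- py :* qx) := qx :* py :- qy :* px)
    ≈-refl px py qx qy)

-- Both coordinates of `det p q • d` are combinations of the two vanishing determinants, so
-- `det p q ≉ 0` would force `d` to vanish.
det-trans≈0 : ∀ {p d q} → ¬ (d ≈² 0²) → det p d ≈ 0ℝ → det q d ≈ 0ℝ → det p q ≈ 0ℝ
det-trans≈0 {px , py} {dx , dy} {qx , qy} d≉0 hp hq = ≈0-stable λ pq≉0 → d≉0
  ( *≈0⇒≈0 (≈0-by (+≈0 (*≈0 qx hp) (*≈0 (- px) hq))
      (solve 6 (λ px py dx dy qx qy →
        qx :* (px :* dy :- py :* dx) :+ (:- px) :* (qx :* dy :- qy :* dx) := (px :* qy :- py :* qx) :* dx)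
        ≈-refl px py dx dy qx qy)) pq≉0
  , *≈0⇒≈0 (≈0-by (+≈0 (*≈0 qy hp) (*≈0 (- py) hq))
      (solve 6 (λ px py dx dy qx qy →
        qy :* (px :* dy :- py :* dx) :+ (:- py) :* (qx :* dy :- qy :* dx) := (px :* qy :- py :* qx) :* dy)
        ≈-refl px py dx dy qx qy)) pq≉0 )

module OnLine (d : ℝ²) where

  infix 4 _~_
  _~_ : ℝ² → ℝ² → Set
  p ~ q = det (p -² q) d ≈ 0ℝ

  ~-sym : ∀ {p q} → p ~ q → q ~ p
  ~-sym {px , py} {qx , qy} h = let dx , dy = d in ≈0-by (*≈0 (- 1ℝ) h)
    (solve 6 (λ px py qx qy dx dy →
      (:- con 1ℚ) :* ((px :- qx) :* dy :- (py :- qy) :* dx) := (qx :- px) :* dy :- (qy :- py) :* dx)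
      ≈-refl px py qx qy dx dy)

  ~-trans : ∀ {p q r} → p ~ q → q ~ r → p ~ r
  ~-trans {px , py} {qx , qy} {rx , ry} h k = let dx , dy = d in ≈0-by (+≈0 h k)
    (solve 8 (λ px py qx qy rx ry dx dy →
      ((px :- qx) :* dy :- (py :- qy) :* dx) :+ ((qx :- rx) :* dy :- (qy :- ry) :* dx)
        := (px :- rx) :* dy :- (py :- ry) :* dx)
      ≈-refl px py qx qy rx ry dx dy)

-- All that is used about segments in direction d.
record Linear (d : ℝ²) (S : PlaneSet) : Set where
  field
    parallel : ∀ {p q} → S p → S q → det (p -² q) d ≈ 0ℝ
    between  : ∀ {p q r} t → S p → S q → 0ℝ ≤ t → t ≤ 1ℝ → r ≈² p +² t • (q -² p) → S r

  respects : ∀ {p q} → S p → q ≈² p → S q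
  respects {px , py} {qx , qy} Sp (qx≈ , qy≈) = between 0ℝ Sp Sp 0≤0 (<⇒≤ 0<1)
    ( ≈-trans qx≈ (solve 1 (λ p → p := p :+ con 0ℚ :* (p :- p)) ≈-refl px)
    , ≈-trans qy≈ (solve 1 (λ p → p := p :+ con 0ℚ :* (p :- p)) ≈-refl py) )

segment⇒linear : ∀ {d S} → SegmentInDirection d S → Linear d S
segment⇒linear {dx , dy} ((ax , ay) , (bx , by) , _ , b-a∥d , S⊆ , ⊆S) = record
  { parallel = λ {(px , py)} {(qx , qy)} Sp Sq →
      let t , _ , _ , px≈ , py≈ = S⊆ Sp
          s , _ , _ , qx≈ , qy≈ = S⊆ Sq
      in ≈0-by (+≈0 (*≈0 (t - s) (∥⇒det≈0 b-a∥d))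
           (+≈0 (*≈0 dy (+≈0 (≈⇒-≈0 px≈) (*≈0 (- 1ℝ) (≈⇒-≈0 qx≈))))
                (*≈0 (- dx) (+≈0 (≈⇒-≈0 py≈) (*≈0 (- 1ℝ) (≈⇒-≈0 qy≈))))))
         (solve 12 (λ dx dy ax ay bx by px py qx qy t s →
           (t :- s) :* ((bx :- ax) :* dy :- (by :- ay) :* dx)
           :+ (dy :* ((px :- (ax :+ t :* (bx :- ax))) :+ (:- con 1ℚ) :* (qx :- (ax :+ s :* (bx :- ax))))
           :+ (:- dx) :* ((py :- (ay :+ t :* (by :- ay))) :+ (:- con 1ℚ) :* (qy :- (ay :+ s :* (by :- ay)))))
           := (px :- qx) :* dy :- (py :- qy) :* dx)
           ≈-refl dx dy ax ay bx by px py qx qy t s)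
  ; between = λ {(px , py)} {(qx , qy)} {(rx , ry)} τ Sp Sq 0≤τ τ≤1 (rx≈ , ry≈) →
      let t , 0≤t , t≤1 , px≈ , py≈ = S⊆ Sp
          s , 0≤s , s≤1 , qx≈ , qy≈ = S⊆ Sq
          coordinate : ∀ {a b p q r} → p ≈ a + t * (b - a) → q ≈ a + s * (b - a) → r ≈ p + τ * (q - p) →
            r ≈ a + (t + τ * (s - t)) * (b - a)
          coordinate {a} {b} p≈ q≈ r≈ = ≈-trans r≈ (≈-trans
            (+-cong p≈ (*-cong (≈-refl {τ}) (+-cong q≈ (-‿cong p≈))))
            (solve 5 (λ a b t s τ →
              a :+ t :* (b :- a) :+ τ :* (a :+ s :* (b :- a) :- (a :+ t :* (b :- a)))
                := a :+ (t :+ τ :* (s :- t)) :* (b :- a)) ≈-refl a b t s τ))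
      in ⊆S ( t + τ * (s - t)
            , 0≤-resp-≈ (solve 3 (λ t s τ → (con 1ℚ :- τ) :* t :+ τ :* s := t :+ τ :* (s :- t)) ≈-refl t s τ)
                (0≤-+ (0≤-* (≤⇒0≤ τ≤1) 0≤t) (0≤-* 0≤τ 0≤s))
            , ≤-by _ (0≤-+ (0≤-* (≤⇒0≤ τ≤1) (≤⇒0≤ t≤1)) (0≤-* 0≤τ (≤⇒0≤ s≤1)))
                (solve 3 (λ t s τ → (con 1ℚ :- τ) :* (con 1ℚ :- t) :+ τ :* (con 1ℚ :- s)
                  := con 1ℚ :- (t :+ τ :* (s :- t))) ≈-refl t s τ)
            , coordinate px≈ qx≈ rx≈ , coordinate py≈ qy≈ ry≈ )
  }

linear-∥ : ∀ {d d′ S} → ¬ (d ≈² 0²) → d ∥ d′ → Linear d S → Linear d′ S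
linear-∥ d≉0 d∥d′ lin = record
  { parallel = λ Sp Sq → det-trans≈0 d≉0 (parallel Sp Sq) (det-sym≈0 (∥⇒det≈0 d∥d′))
  ; between = between }
  where open Linear lin

det≈0⇒≈0 : ∀ {w d e} → det w d ≈ 0ℝ → det w e ≈ 0ℝ → ¬ (det d e ≈ 0ℝ) → w ≈² 0²
det≈0⇒≈0 {wx , wy} {dx , dy} {ex , ey} wd we de≉0 =
  ( *≈0⇒≈0 (≈0-by (+≈0 (*≈0 dx we) (*≈0 (- ex) wd))
      (solve 6 (λ wx wy dx dy ex ey → dx :* (wx :* ey :- wy :* ex) :+ (:- ex) :* (wx :* dy :- wy :* dx)
        := (dx :* ey :- dy :* ex) :* wx) ≈-refl wx wy dx dy ex ey)) de≉0
  , *≈0⇒≈0 (≈0-by (+≈0 (*≈0 dy we) (*≈0 (- ey) wd))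
      (solve 6 (λ wx wy dx dy ex ey → dy :* (wx :* ey :- wy :* ex) :+ (:- ey) :* (wx :* dy :- wy :* dx)
        := (dx :* ey :- dy :* ex) :* wy) ≈-refl wx wy dx dy ex ey)) de≉0 )

-≈0⇒≈² : ∀ {p q} → p -² q ≈² 0² → p ≈² q
-≈0⇒≈² (x≈ , y≈) = ≈-sym (≈-by x≈ ≈-refl) , ≈-sym (≈-by y≈ ≈-refl)

-- H and H′ lie on the line of R, and A crosses that line in at most one point.
transversal⇒meet : ∀ {a d A R H H′} → Linear a A → Linear d R → Linear d H → Linear d H′ →
  ¬ (det a d ≈ 0ℝ) → R ≬ H → R ≬ H′ → A ≬ H → A ≬ H′ → H ≬ H′
transversal⇒meet {a} {d} linA linR linH linH′ ad≉0 (z , Rz , Hz) (z′ , Rz′ , H′z′) (x , Ax , Hx) (x′ , Ax′ , H′x′) =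
  -- `x` and `x′` both lie on `A`, so their difference is parallel to `a`; through `z` and `z′` it
  -- is also parallel to `d`. Hence the two points coincide.
  x , Hx , Linear.respects linH′ H′x′ (-≈0⇒≈² (det≈0⇒≈0 (Linear.parallel linA Ax Ax′)
    (~-trans {q = z} (Linear.parallel linH Hx Hz)
      (~-trans {q = z′} (Linear.parallel linR Rz Rz′) (Linear.parallel linH′ H′z′ H′x′))) ad≉0))
  where open OnLine d

-- When `f d` is nonzero, `f` is a coordinate on each line in direction `d`, and the order of points
-- there becomes the order of real numbers.
module Functional (α β : ℝ) where

  f : ℝ² → ℝ
  f (x , y) = α * x + β * y

  f≈0⇒≈0 : ∀ {w d} → ¬ (f d ≈ 0ℝ) → det w d ≈ 0ℝ → f w ≈ 0ℝ → w ≈² 0²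
  f≈0⇒≈0 {wx , wy} {dx , dy} fd≉0 wd fw =
    ( *≈0⇒≈0 (≈0-by (+≈0 (*≈0 β wd) (*≈0 dx fw))
        (solve 6 (λ wx wy dx dy α β → β :* (wx :* dy :- wy :* dx) :+ dx :* (α :* wx :+ β :* wy)
          := (α :* dx :+ β :* dy) :* wx) ≈-refl wx wy dx dy α β)) fd≉0
    , *≈0⇒≈0 (≈0-by (+≈0 (*≈0 (- α) wd) (*≈0 dy fw))
        (solve 6 (λ wx wy dx dy α β → (:- α) :* (wx :* dy :- wy :* dx) :+ dy :* (α :* wx :+ β :* wy)
          := (α :* dx :+ β :* dy) :* wy) ≈-refl wx wy dx dy α β)) fd≉0 )

  f-mono⇒between : ∀ {d p q r} → ¬ (f d ≈ 0ℝ) → det (p -² q) d ≈ 0ℝ → det (p -² r) d ≈ 0ℝ →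
    f p ≤ f q → f q ≤ f r → ¬ ¬ (Σ[ t ∈ ℝ ] 0ℝ ≤ t × t ≤ 1ℝ × q ≈² p +² t • (r -² p))
  f-mono⇒between {dx , dy} {p@(px , py)} {q@(qx , qy)} {r@(rx , ry)} fd≉0 pq pr p≤q q≤r k =
    0≤-cases (≤⇒0≤ (≤-trans p≤q q≤r)) λ where
      (inj₁ 0<r-p) → let M , 0<M , inv = inverse 0<r-p in
        k ( (f q - f p) * M , 0≤-* (≤⇒0≤ p≤q) (0<⇒0≤ 0<M)
          , ≤-by _ (0≤-+ (0≤-* (≤⇒0≤ q≤r) (0<⇒0≤ 0<M)) (≈0⇒0≤ (≈⇒-≈0 (≈-sym inv))))
              (solve 4 (λ p q r M → (r :- q) :* M :+ (con 1ℚ :- (r :- p) :* M) := con 1ℚ :- (q :- p) :* M)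
                ≈-refl (f p) (f q) (f r) M)
          , -≈0⇒≈² (on-line ((f q - f p) * M) (≈0-by (*≈0 (f p - f q) (≈⇒-≈0 inv))
              (solve 9 (λ px py qx qy rx ry α β M →
                let fp = α :* px :+ β :* py ; fq = α :* qx :+ β :* qy ; fr = α :* rx :+ β :* ry
                    t = (fq :- fp) :* M in
                (fp :- fq) :* ((fr :- fp) :* M :- con 1ℚ)
                  := α :* (qx :- (px :+ t :* (rx :- px))) :+ β :* (qy :- (py :+ t :* (ry :- py))))
                ≈-refl px py qx qy rx ry α β M))) )
      -- All three values coincide, so `q` equals `p` and the parameter 0 serves.
      (inj₂ r-p≈0) →
        let q-p≈0 : f q - f p ≈ 0ℝ
            q-p≈0 = ≤-antisym (≤-by _ (≤⇒0≤ q≤r) (≈-trans (≈-trans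
              (solve 3 (λ p q r → r :- q := (r :- p) :- (q :- p)) ≈-refl (f p) (f q) (f r))
              (+-cong r-p≈0 ≈-refl)) ≈-refl)) (≤-by _ (≤⇒0≤ p≤q)
              (solve 2 (λ p q → q :- p := (q :- p) :- con 0ℚ) ≈-refl (f p) (f q)))
        in k (0ℝ , 0≤0 , <⇒≤ 0<1 , -≈0⇒≈² (on-line 0ℝ (≈0-by q-p≈0
          (solve 8 (λ px py qx qy rx ry α β →
            (α :* qx :+ β :* qy) :- (α :* px :+ β :* py)
              := α :* (qx :- (px :+ con 0ℚ :* (rx :- px))) :+ β :* (qy :- (py :+ con 0ℚ :* (ry :- py))))
            ≈-refl px py qx qy rx ry α β))))
    where
    -- A vector along `d` on which `f` vanishes is zero, so the equation in the plane reduces to one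
    -- between values of `f`.
    on-line : ∀ t → f (q -² (p +² t • (r -² p))) ≈ 0ℝ → q -² (p +² t • (r -² p)) ≈² 0²
    on-line t = f≈0⇒≈0 fd≉0 (≈0-by (+≈0 (*≈0 (- 1ℝ) pq) (*≈0 t pr))
      (solve 9 (λ px py qx qy rx ry dx dy t →
        (:- con 1ℚ) :* ((px :- qx) :* dy :- (py :- qy) :* dx) :+ t :* ((px :- rx) :* dy :- (py :- ry) :* dx)
          := (qx :- (px :+ t :* (rx :- px))) :* dy :- (qy :- (py :+ t :* (ry :- py))) :* dx)
        ≈-refl px py qx qy rx ry dx dy t))

nonvanishing-functional : ∀ {d} → ¬ (d ≈² 0²) →
  ¬ ¬ (Σ[ α ∈ ℝ ] Σ[ β ∈ ℝ ] ¬ (Functional.f α β d ≈ 0ℝ))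
nonvanishing-functional {x , y} d≉0 k = k (1ℝ , 0ℝ , λ fx → k (0ℝ , 1ℝ , λ fy → d≉0
  ( ≈0-by fx (solve 2 (λ x y → con 1ℚ :* x :+ con 0ℚ :* y := x) ≈-refl x y)
  , ≈0-by fy (solve 2 (λ x y → con 0ℚ :* x :+ con 1ℚ :* y := y) ≈-refl x y) )))

-- Of three intervals on a line that meet pairwise, one lies in the union of the others.
no-three-collinear : ∀ {d} → ¬ (d ≈² 0²) → (S : Fin 3 → PlaneSet) → (∀ i → Linear d (S i)) →
  (∀ i j → i ≢ j → S i ≬ S j) → (q : Fin 3 → ℝ²) → (∀ i → S i (q i)) →
  ¬ (∀ i j → i ≢ j → ¬ S j (q i))
no-three-collinear {d} d≉0 S lin meet q Sq private-q = nonvanishing-functional d≉0 λ (α , β , fd≉0) →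
  let
  open Functional α β
  -- The outer sets share a point `z`. The middle point `q j` lies between `q i` and `z` or between
  -- `z` and `q l`, hence in one of the outer sets, against its privacy.
  middle : ∀ i j l → j ≢ i → j ≢ l → i ≢ l → f (q i) ≤ f (q j) → ¬ (f (q j) ≤ f (q l))
  middle i j l j≢i j≢l i≢l fi≤fj fj≤fl =
    let z , Siz , Slz = meet i l i≢l in
    ≤⊎< (f (q j)) (f z) λ where
      (inj₁ fj≤fz) → f-mono⇒between fd≉0 (q~q i j (λ i≡j → j≢i (sym i≡j))) (Linear.parallel (lin i) (Sq i) Siz)
        fi≤fj fj≤fz λ (t , 0≤t , t≤1 , eq) →
          private-q j i j≢i (Linear.between (lin i) t (Sq i) Siz 0≤t t≤1 eq)
      (inj₂ fz<fj) → f-mono⇒between fd≉0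
        (~-trans {q = q l} (Linear.parallel (lin l) Slz (Sq l)) (q~q l j λ l≡j → j≢l (sym l≡j)))
        (Linear.parallel (lin l) Slz (Sq l)) (<⇒≤ fz<fj) fj≤fl λ (t , 0≤t , t≤1 , eq) →
          private-q j l j≢l (Linear.between (lin l) t Slz (Sq l) 0≤t t≤1 eq)
  in
  ≤⊎< (f (q 0F)) (f (q 1F)) λ where
    (inj₁ 0≤1) → ≤⊎< (f (q 1F)) (f (q 2F)) λ where
      (inj₁ 1≤2) → middle 0F 1F 2F (λ ()) (λ ()) (λ ()) 0≤1 1≤2
      (inj₂ 2<1) → ≤⊎< (f (q 0F)) (f (q 2F)) λ where
        (inj₁ 0≤2) → middle 0F 2F 1F (λ ()) (λ ()) (λ ()) 0≤2 (<⇒≤ 2<1)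
        (inj₂ 2<0) → middle 2F 0F 1F (λ ()) (λ ()) (λ ()) (<⇒≤ 2<0) 0≤1
    (inj₂ 1<0) → ≤⊎< (f (q 0F)) (f (q 2F)) λ where
      (inj₁ 0≤2) → middle 1F 0F 2F (λ ()) (λ ()) (λ ()) (<⇒≤ 1<0) 0≤2
      (inj₂ 2<0) → ≤⊎< (f (q 1F)) (f (q 2F)) λ where
        (inj₁ 1≤2) → middle 1F 2F 0F (λ ()) (λ ()) (λ ()) 1≤2 (<⇒≤ 2<0)
        (inj₂ 2<1) → middle 2F 1F 0F (λ ()) (λ ()) (λ ()) (<⇒≤ 2<1) (<⇒≤ 1<0)
  where
  open OnLine d
  q~q : ∀ i j → i ≢ j → q i ~ q j
  q~q i j i≢j = let z , Siz , Sjz = meet i j i≢j in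
    ~-trans {q = z} (Linear.parallel (lin i) (Sq i) Siz) (Linear.parallel (lin j) Sjz (Sq j))

-- Graphs

-- Vertices come from any type in bijection with `Fin size`, so that structured vertices can be
-- pattern matched; `graph` transports adjacency along the bijection.
record FiniteGraph : Set₁ where
  field
    {size}    : ℕ
    V         : Set
    indexing  : Fin size ↔ V
    _~_       : Rel V 0ℓ
    _~?_      : Decidable _~_
    ~-sym     : Symmetric _~_
    ~-irrefl  : Irreflexive _≡_ _~_

  open Inverse indexing public using (to; from; strictlyInverseˡ; strictlyInverseʳ)

  to-injective : ∀ {i j} → to i ≡ to j → i ≡ j
  to-injective {i} {j} eq = trans (sym (strictlyInverseʳ i)) (trans (cong from eq) (strictlyInverseʳ j))

  graph : Graph
  graph = record
    { order = size
    ; Adj = λ i j → to i ~ to j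
    ; adj? = λ i j → to i ~? to j
    ; symmetric = ~-sym
    ; loopless = λ { refl → ~-irrefl refl }
    }

  Represents : (V → V → Set) → Set
  Represents Meet = ∀ u v → (u ~ v → Meet u v) × (u ≢ v → Meet u v → u ~ v)

  represents⇒intersectionGraph : ∀ F → Represents (λ u v → F u ≬ F v) →
    IsIntersectionGraphOf graph (F ∘ to)
  represents⇒intersectionGraph F rep i j = mk⇔
    (λ i~j → (λ { refl → ~-irrefl refl i~j }) , proj₁ (rep (to i) (to j)) i~j)
    (λ (i≢j , meet) → proj₂ (rep (to i) (to j)) (λ eq → i≢j (to-injective eq)) meet)

  intersectionGraph⇒represents : ∀ F → IsIntersectionGraphOf graph F →
    Represents (λ u v → F (from u) ≬ F (from v))
  intersectionGraph⇒represents F isG u v =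
    (λ u~v → proj₂ (to⇔ (subst₂ _~_ (sym (strictlyInverseˡ u)) (sym (strictlyInverseˡ v)) u~v))) ,
    (λ u≢v meet → subst₂ _~_ (strictlyInverseˡ u) (strictlyInverseˡ v)
      (from⇔ ((λ eq → u≢v (trans (sym (strictlyInverseˡ u)) (trans (cong to eq) (strictlyInverseˡ v)))) , meet)))
    where open Equivalence (isG (from u) (from v)) renaming (to to to⇔; from to from⇔)

-- Comparability graphs of complete binary trees

Tree : ℕ → Set
Tree zero    = ⊤
Tree (suc k) = ⊤ ⊎ (Tree k ⊎ Tree k)

pattern root    = inj₁ tt
pattern left x  = inj₂ (inj₁ x)
pattern right x = inj₂ (inj₂ x)

treeSize : ℕ → ℕ
treeSize zero    = 1
treeSize (suc k) = 1 ℕ.+ (treeSize k ℕ.+ treeSize k)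

tree-indexing : ∀ k → Fin (treeSize k) ↔ Tree k
tree-indexing zero    = Fin.1↔⊤
tree-indexing (suc k) = (Fin.1↔⊤ ⊎-↔ ((tree-indexing k ⊎-↔ tree-indexing k) ↔-∘ Fin.+↔⊎)) ↔-∘ Fin.+↔⊎

Comparable : ∀ k → Rel (Tree k) 0ℓ
Comparable zero    _         _         = ⊥
Comparable (suc k) root      root      = ⊥
Comparable (suc k) root      (inj₂ _)  = ⊤
Comparable (suc k) (inj₂ _)  root      = ⊤
Comparable (suc k) (left x)  (left y)  = Comparable k x y
Comparable (suc k) (left _)  (right _) = ⊥
Comparable (suc k) (right _) (left _)  = ⊥
Comparable (suc k) (right x) (right y) = Comparable k x y

comparable? : ∀ k → Decidable (Comparable k)
comparable? zero    _         _         = no λ ()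
comparable? (suc k) root      root      = no λ ()
comparable? (suc k) root      (inj₂ _)  = yes tt
comparable? (suc k) (inj₂ _)  root      = yes tt
comparable? (suc k) (left x)  (left y)  = comparable? k x y
comparable? (suc k) (left _)  (right _) = no λ ()
comparable? (suc k) (right _) (left _)  = no λ ()
comparable? (suc k) (right x) (right y) = comparable? k x y

comparable-sym : ∀ k → Symmetric (Comparable k)
comparable-sym (suc k) {root}    {inj₂ _}  _ = tt
comparable-sym (suc k) {inj₂ _}  {root}    _ = tt
comparable-sym (suc k) {left x}  {left y}  p = comparable-sym k p
comparable-sym (suc k) {right x} {right y} p = comparable-sym k p

comparable-irrefl : ∀ k x → ¬ Comparable k x x
comparable-irrefl (suc k) (left x)  = comparable-irrefl k x
comparable-irrefl (suc k) (right x) = comparable-irrefl k x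

MonochromaticFork : ∀ k {A : Set} → (Tree k → A) → Set
MonochromaticFork k c = ∃[ r ] ∃[ x ] ∃[ y ]
  Comparable k r x × Comparable k r y × x ≢ y × ¬ Comparable k x y × c r ≡ c x × c r ≡ c y

-- If the colour of the root recurs on both sides we are done; otherwise one of the
-- subtrees uses one colour less.
k-coloured-tree⇒fork : ∀ k (c : Tree k → Fin k) → ¬ ¬ MonochromaticFork k c
-- `Tree k` has one level more than there are colours, so the induction ends with a node for which
-- no colour is left.
k-coloured-tree⇒fork zero    c _       = Fin.¬Fin0 (c tt)
k-coloured-tree⇒fork (suc k) c no-fork = avoids left lift-left λ x cx → avoids right lift-right λ y cy →
  no-fork (root , left x , right y , tt , tt , (λ ()) , (λ ()) , cx , cy)
  where
  avoids : (side : Tree k → Tree (suc k)) →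
    (MonochromaticFork k (c ∘ side) → MonochromaticFork (suc k) c) →
    ¬ (∀ x → c root ≢ c (side x))
  -- `punchOut` deletes the colour of the root, and its injectivity turns a fork for the reduced
  -- colouring into one for `c`.
  avoids side lift ≢root = k-coloured-tree⇒fork k (λ x → punchOut (≢root x))
    λ (r , x , y , r~x , r~y , x≢y , x≁y , rx , ry) → no-fork (lift
      (r , x , y , r~x , r~y , x≢y , x≁y
      , Fin.punchOut-injective (≢root r) (≢root x) rx , Fin.punchOut-injective (≢root r) (≢root y) ry))
  lift-left : MonochromaticFork k (λ x → c (left x)) → MonochromaticFork (suc k) c
  lift-left (r , x , y , r~x , r~y , x≢y , rest) =
    left r , left x , left y , r~x , r~y , (λ { refl → x≢y refl }) , rest
  lift-right : MonochromaticFork k (λ x → c (right x)) → MonochromaticFork (suc k) c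
  lift-right (r , x , y , r~x , r~y , x≢y , rest) =
    right r , right x , right y , r~x , r~y , (λ { refl → x≢y refl }) , rest

-- The net and its segment representations

pattern corner i  = inj₁ i
pattern pendant i = inj₂ (inj₁ i)
pattern node x    = inj₂ (inj₂ x)

module Net (k : ℕ) where

  Vertex : Set
  Vertex = Fin 3 ⊎ (Fin 3 ⊎ Tree k)

  Adjacent : Rel Vertex 0ℓ
  Adjacent (corner i)  (corner j)  = i ≢ j
  Adjacent (corner i)  (pendant j) = i ≡ j
  Adjacent (corner i)  (node _)    = ⊤
  Adjacent (pendant i) (corner j)  = j ≡ i
  Adjacent (pendant _) (pendant _) = ⊥
  Adjacent (pendant _) (node _)    = ⊥
  Adjacent (node _)    (corner _)  = ⊤
  Adjacent (node _)    (pendant _) = ⊥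
  Adjacent (node x)    (node y)    = Comparable k x y

  adjacent? : Decidable Adjacent
  adjacent? (corner i)  (corner j)  = ¬? (i Fin.≟ j)
  adjacent? (corner i)  (pendant j) = i Fin.≟ j
  adjacent? (corner i)  (node _)    = yes tt
  adjacent? (pendant i) (corner j)  = j Fin.≟ i
  adjacent? (pendant _) (pendant _) = no λ ()
  adjacent? (pendant _) (node _)    = no λ ()
  adjacent? (node _)    (corner _)  = yes tt
  adjacent? (node _)    (pendant _) = no λ ()
  adjacent? (node x)    (node y)    = comparable? k x y

  adjacent-sym : Symmetric Adjacent
  adjacent-sym {corner i}  {corner j}  i≢j = λ j≡i → i≢j (sym j≡i)
  adjacent-sym {corner i}  {pendant j} i≡j = i≡j
  adjacent-sym {corner i}  {node _}    _   = tt
  adjacent-sym {pendant i} {corner j}  j≡i = j≡i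
  adjacent-sym {pendant _} {pendant _} ()
  adjacent-sym {pendant _} {node _}    ()
  adjacent-sym {node _}    {corner _}  _   = tt
  adjacent-sym {node x}    {node y}    x~y = comparable-sym k x~y

  adjacent-irrefl : Irreflexive _≡_ Adjacent
  adjacent-irrefl {corner i} refl i≢i = i≢i refl
  adjacent-irrefl {node x}   refl x~x = comparable-irrefl k x x~x

  net : FiniteGraph
  net = record
    { V = Vertex
    ; indexing = (↔-refl ⊎-↔ ((↔-refl ⊎-↔ tree-indexing k) ↔-∘ Fin.+↔⊎)) ↔-∘ Fin.+↔⊎
    ; _~_ = Adjacent
    ; _~?_ = adjacent?
    ; ~-sym = λ {u} {v} → adjacent-sym {u} {v}
    ; ~-irrefl = λ {u} {v} → adjacent-irrefl {u} {v}
    }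

  open FiniteGraph net using (graph; from; intersectionGraph⇒represents)

  net∉k-DIR : ¬ (k -DIR) graph
  net∉k-DIR (d , d≉0 , F , directions , isG) =
    with-parallel (pairwise-parallel 0F 1F λ ()) (pairwise-parallel 0F 2F λ ())
    where
    S : Vertex → PlaneSet
    S u = F (from u)

    colour : Vertex → Fin k
    colour u = proj₁ (directions (from u))

    linear : ∀ u → Linear (d (colour u)) (S u)
    linear u = segment⇒linear (proj₂ (directions (from u)))

    rep = intersectionGraph⇒represents F isG

    meet : ∀ u v → Adjacent u v → S u ≬ S v
    meet u v = proj₁ (rep u v)

    apart : ∀ u v → u ≢ v → ¬ Adjacent u v → ¬ (S u ≬ S v)
    apart u v u≢v u≁v m = u≁v (proj₂ (rep u v) u≢v m)

    no-transversal : ∀ i {r x y} → Comparable k r x → Comparable k r y → x ≢ y → ¬ Comparable k x y →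
      colour (node r) ≡ colour (node x) → colour (node r) ≡ colour (node y) →
      ¬ ¬ (det (d (colour (corner i))) (d (colour (node r))) ≈ 0ℝ)
    no-transversal i {r} {x} {y} r~x r~y x≢y x≁y rx ry transversal =
      apart (node x) (node y) (λ { refl → x≢y refl }) x≁y
        (transversal⇒meet (linear (corner i)) (linear (node r))
          (subst (λ c → Linear (d c) (S (node x))) (sym rx) (linear (node x)))
          (subst (λ c → Linear (d c) (S (node y))) (sym ry) (linear (node y)))
          transversal (meet (node r) (node x) r~x) (meet (node r) (node y) r~y)
          (meet (corner i) (node x) tt) (meet (corner i) (node y) tt))

    pairwise-parallel : ∀ i j → i ≢ j → det (d (colour (corner i))) (d (colour (corner j))) ≈ 0ℝ
    -- Both corners are compared with one fork: each is parallel to its common direction. The fork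
    -- exists only under ¬ ¬, but being parallel is stable.
    pairwise-parallel i j i≢j = ≈0-stable λ not-parallel →
      k-coloured-tree⇒fork k (λ x → colour (node x)) λ (r , x , y , r~x , r~y , x≢y , x≁y , rx , ry) →
        no-transversal i r~x r~y x≢y x≁y rx ry λ ir →
        no-transversal j r~x r~y x≢y x≁y rx ry λ jr →
        not-parallel (det-trans≈0 (d≉0 (colour (node r))) ir jr)

    with-parallel : det (d (colour (corner 0F))) (d (colour (corner 1F))) ≈ 0ℝ →
      det (d (colour (corner 0F))) (d (colour (corner 2F))) ≈ 0ℝ → ⊥
    with-parallel ∥₁ ∥₂ = no-three-collinear (d≉0 (colour (corner 0F))) (λ i → S (corner i))
      (λ where
        0F → linear (corner 0F)
        1F → linear-∥ (d≉0 _) (det≈0⇒∥ (det-sym≈0 ∥₁)) (linear (corner 1F))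
        2F → linear-∥ (d≉0 _) (det≈0⇒∥ (det-sym≈0 ∥₂)) (linear (corner 2F)))
      (λ i j i≢j → meet (corner i) (corner j) i≢j)
      -- The private point of a corner is where its pendant meets it, as that pendant misses the
      -- other corners.
      (λ i → proj₁ (meet (corner i) (pendant i) refl))
      (λ i → proj₁ (proj₂ (meet (corner i) (pendant i) refl)))
      (λ i j i≢j Sj → apart (corner j) (pendant i) (λ ()) (λ j≡i → i≢j (sym j≡i))
        (_ , Sj , proj₂ (proj₂ (meet (corner i) (pendant i) refl))))

-- Convex bodies

-- Convexity is stated for three points because the square will be filled by combinations of the
-- corners of a triangle; two points are the case of a repeated one. Maxima are attained only under
-- ¬ ¬, since finding an extreme vertex means comparing reals.
record Body (K : PlaneSet) : Set where
  field
    convex   : ∀ {p q r z : ℝ²} a b c → K p → K q → K r → 0ℝ ≤ a → 0ℝ ≤ b → 0ℝ ≤ c →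
      a + b + c ≈ 1ℝ → z ≈² a • p +² b • q +² c • r → K z
    extremal : ∀ α β → ¬ ¬ (Σ[ p ∈ ℝ² ] K p ×
      (∀ {q} → K q → α * proj₁ q + β * proj₂ q ≤ α * proj₁ p + β * proj₂ p))

  respects : ∀ {p q} → K p → q ≈² p → K q
  respects {px , py} Kp (qx≈ , qy≈) = convex 1ℝ 0ℝ 0ℝ Kp Kp Kp (<⇒≤ 0<1) 0≤0 0≤0
    (solve 0 (con 1ℚ :+ con 0ℚ :+ con 0ℚ := con 1ℚ) ≈-refl)
    (≈-trans qx≈ (lemma px) , ≈-trans qy≈ (lemma py))
    where
    lemma : ∀ x → x ≈ 1ℝ * x + 0ℝ * x + 0ℝ * x
    lemma = solve 1 (λ x → x := con 1ℚ :* x :+ con 0ℚ :* x :+ con 0ℚ :* x) ≈-refl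

  between : ∀ {p q r} t → K p → K q → 0ℝ ≤ t → t ≤ 1ℝ → r ≈² p +² t • (q -² p) → K r
  between {px , py} {qx , qy} t Kp Kq 0≤t t≤1 (rx≈ , ry≈) =
    convex (1ℝ - t) t 0ℝ Kp Kq Kq (≤⇒0≤ t≤1) 0≤t 0≤0
      (solve 1 (λ t → con 1ℚ :- t :+ t :+ con 0ℚ := con 1ℚ) ≈-refl t)
      (≈-trans rx≈ (lemma px qx) , ≈-trans ry≈ (lemma py qy))
    where
    lemma : ∀ p q → p + t * (q - p) ≈ (1ℝ - t) * p + t * q + 0ℝ * q
    lemma p q = solve 3 (λ p q t → p :+ t :* (q :- p) := (con 1ℚ :- t) :* p :+ t :* q :+ con 0ℚ :* q)
      ≈-refl p q t

sum-linear₃ : ∀ {n} a b c (f g h : Vector ℝ n) →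
  sum (λ i → a * f i + b * g i + c * h i) ≈ a * sum f + b * sum g + c * sum h
sum-linear₃ {zero}  a b c f g h =
  solve 3 (λ a b c → con 0ℚ := a :* con 0ℚ :+ b :* con 0ℚ :+ c :* con 0ℚ) ≈-refl a b c
sum-linear₃ {suc n} a b c f g h = ≈-trans
  (+-cong ≈-refl (sum-linear₃ a b c (f ∘ suc) (g ∘ suc) (h ∘ suc)))
  (solve 9 (λ a b c f g h F G H →
    a :* f :+ b :* g :+ c :* h :+ (a :* F :+ b :* G :+ c :* H)
      := a :* (f :+ F) :+ b :* (g :+ G) :+ c :* (h :+ H))
    ≈-refl a b c (f zero) (g zero) (h zero) (sum (f ∘ suc)) (sum (g ∘ suc)) (sum (h ∘ suc)))

weighted-sum-≤ : ∀ {n} M (w f : Vector ℝ n) → (∀ i → 0ℝ ≤ w i) → (∀ i → f i ≤ M) →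
  sum (λ i → w i * f i) ≤ sum w * M
weighted-sum-≤ {zero}  M w f 0≤w f≤M = ≈⇒≤ (solve 1 (λ M → con 0ℚ := con 0ℚ :* M) ≈-refl M)
weighted-sum-≤ {suc n} M w f 0≤w f≤M = ≤-by _
  (0≤-+ (0≤-* (0≤w zero) (≤⇒0≤ (f≤M zero)))
        (≤⇒0≤ (weighted-sum-≤ M (w ∘ suc) (f ∘ suc) (0≤w ∘ suc) (f≤M ∘ suc))))
  (solve 5 (λ w f M W F → w :* (M :- f) :+ (W :* M :- F) := (w :+ W) :* M :- (w :* f :+ F))
    ≈-refl (w zero) (f zero) M (sum (w ∘ suc)) (sum (λ i → w (suc i) * f (suc i))))

unit : ∀ {n} → Fin n → Vector ℝ n
unit zero    zero    = 1ℝ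
unit zero    (suc _) = 0ℝ
unit (suc _) zero    = 0ℝ
unit (suc i) (suc j) = unit i j

0≤unit : ∀ {n} (i j : Fin n) → 0ℝ ≤ unit i j
0≤unit zero    zero    = <⇒≤ 0<1
0≤unit zero    (suc _) = 0≤0
0≤unit (suc _) zero    = 0≤0
0≤unit (suc i) (suc j) = 0≤unit i j

sum-0* : ∀ {n} (f : Vector ℝ n) → sum (λ i → 0ℝ * f i) ≈ 0ℝ
sum-0* {zero}  f = ≈-refl
sum-0* {suc n} f = ≈-trans (+-cong ≈-refl (sum-0* (f ∘ suc)))
  (solve 1 (λ x → con 0ℚ :* x :+ con 0ℚ := con 0ℚ) ≈-refl (f zero))

sum-unit : ∀ {n} (i : Fin n) (f : Vector ℝ n) → sum (λ j → unit i j * f j) ≈ f i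
sum-unit zero    f = ≈-trans (+-cong ≈-refl (sum-0* (f ∘ suc)))
  (solve 1 (λ x → con 1ℚ :* x :+ con 0ℚ := x) ≈-refl (f zero))
sum-unit (suc i) f = ≈-trans (+-cong ≈-refl (sum-unit i (f ∘ suc)))
  (solve 2 (λ x y → con 0ℚ :* x :+ y := y) ≈-refl (f zero) (f (suc i)))

vertex∈hull : ∀ {n} (v : Vector ℝ² n) i → ConvexHull v (v i)
vertex∈hull v i = unit i , 0≤unit i ,
  ≈-trans (sum-cong-≋ (λ j → solve 1 (λ x → x := x :* con 1ℚ) ≈-refl (unit i j))) (sum-unit i (λ _ → 1ℝ)) ,
  ≈-sym (sum-unit i (proj₁ ∘ v)) , ≈-sym (sum-unit i (proj₂ ∘ v))

argmax : ∀ {n} (f : Vector ℝ (suc n)) → ¬ ¬ (∃[ i ] ∀ j → f j ≤ f i)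
argmax {zero}  f k = k (zero , λ { zero → ≈⇒≤ ≈-refl })
argmax {suc n} f k = argmax (f ∘ suc) λ (i , max) → ≤⊎< (f zero) (f (suc i)) λ where
  (inj₁ f₀≤) → k (suc i , λ { zero → f₀≤ ; (suc j) → max j })
  (inj₂ <f₀) → k (zero , λ { zero → ≈⇒≤ ≈-refl ; (suc j) → ≤-trans (max j) (<⇒≤ <f₀) })

hull-body : ∀ {n} (v : Vector ℝ² (suc n)) → Body (ConvexHull v)
hull-body v = record
  { convex = λ {p} {q} {r} a b c (w₁ , 0≤w₁ , Σw₁ , p≈) (w₂ , 0≤w₂ , Σw₂ , q≈) (w₃ , 0≤w₃ , Σw₃ , r≈)
      0≤a 0≤b 0≤c a+b+c z≈ →
      let coordinate : ∀ {x y z t} (f : Vector ℝ _) →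
            x ≈ sum (λ i → w₁ i * f i) → y ≈ sum (λ i → w₂ i * f i) → z ≈ sum (λ i → w₃ i * f i) →
            t ≈ a * x + b * y + c * z →
            t ≈ sum (λ i → (a * w₁ i + b * w₂ i + c * w₃ i) * f i)
          coordinate f x≈ y≈ z≈ t≈ = ≈-trans t≈ (≈-trans
            (+-cong (+-cong (*-cong ≈-refl x≈) (*-cong ≈-refl y≈)) (*-cong ≈-refl z≈))
            (≈-trans (≈-sym (sum-linear₃ a b c (λ i → w₁ i * f i) (λ i → w₂ i * f i) (λ i → w₃ i * f i)))
              (sum-cong-≋ (λ i → solve 7 (λ a b c x y z f →
                a :* (x :* f) :+ b :* (y :* f) :+ c :* (z :* f) := (a :* x :+ b :* y :+ c :* z) :* f)
                ≈-refl a b c (w₁ i) (w₂ i) (w₃ i) (f i)))))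
      in (λ i → a * w₁ i + b * w₂ i + c * w₃ i) ,
         (λ i → 0≤-+ (0≤-+ (0≤-* 0≤a (0≤w₁ i)) (0≤-* 0≤b (0≤w₂ i))) (0≤-* 0≤c (0≤w₃ i))) ,
         ≈-trans (sum-linear₃ a b c w₁ w₂ w₃) (≈-trans
           (+-cong (+-cong (*-cong ≈-refl Σw₁) (*-cong ≈-refl Σw₂)) (*-cong ≈-refl Σw₃))
           (≈-trans (solve 3 (λ a b c → a :* con 1ℚ :+ b :* con 1ℚ :+ c :* con 1ℚ := a :+ b :+ c) ≈-refl a b c)
             a+b+c)) ,
         coordinate (proj₁ ∘ v) (proj₁ p≈) (proj₁ q≈) (proj₁ r≈) (proj₁ z≈) ,
         coordinate (proj₂ ∘ v) (proj₂ p≈) (proj₂ q≈) (proj₂ r≈) (proj₂ z≈)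
  -- A value on the hull is a weighted mean of the values at the points `v`, so the largest of these
  -- is a maximum. A zero third term adapts the sum to `sum-linear₃`.
  ; extremal = λ α β k → argmax (λ i → α * proj₁ (v i) + β * proj₂ (v i)) λ (i , max) →
      k (v i , vertex∈hull v i , λ {q} (w , 0≤w , Σw , x≈ , y≈) →
        let M = α * proj₁ (v i) + β * proj₂ (v i)
            X = sum (λ j → w j * proj₁ (v j))
            Y = sum (λ j → w j * proj₂ (v j)) in
        ≤-trans (≈⇒≤ (≈-trans
          (≈-trans (+-cong (*-cong ≈-refl x≈) (*-cong ≈-refl y≈))
            (solve 4 (λ α β X Y → α :* X :+ β :* Y := α :* X :+ β :* Y :+ con 0ℚ :* Y) ≈-refl α β X Y))
          (≈-trans (≈-sym (sum-linear₃ α β 0ℝ (λ j → w j * proj₁ (v j)) (λ j → w j * proj₂ (v j))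
              (λ j → w j * proj₂ (v j))))
            (sum-cong-≋ (λ j → solve 5 (λ α β w x y →
              α :* (w :* x) :+ β :* (w :* y) :+ con 0ℚ :* (w :* y) := w :* (α :* x :+ β :* y))
              ≈-refl α β (w j) (proj₁ (v j)) (proj₂ (v j)))))))
        (≤-trans (weighted-sum-≤ M w _ 0≤w max)
          (≈⇒≤ (≈-trans (*-cong Σw ≈-refl) (solve 1 (λ M → con 1ℚ :* M := M) ≈-refl M)))))
  }

-- Homothets and the normal position of a body

Homothet : PlaneSet → ℝ → ℝ² → PlaneSet
Homothet K s t q = Σ[ p ∈ ℝ² ] K p × q ≈² s • p +² t

record HomothetRepresentation (K : PlaneSet) (Γ : FiniteGraph) : Set where
  open FiniteGraph Γ
  field
    scale      : V → ℝ
    shift      : V → ℝ²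
    0<scale    : ∀ v → 0ℝ < scale v
    represents : Represents (λ u v → Homothet K (scale u) (shift u) ≬ Homothet K (scale v) (shift v))

homothetGraph⇒representation : ∀ {K} Γ →
  IntersectionGraphs (HomotheticTo K) (FiniteGraph.graph Γ) → HomothetRepresentation K Γ
homothetGraph⇒representation Γ (F , homothetic , isG) = record
  { scale = λ v → proj₁ (homothetic (from v))
  ; shift = λ v → proj₁ (proj₂ (homothetic (from v)))
  ; 0<scale = λ v → proj₁ (proj₂ (proj₂ (homothetic (from v))))
  ; represents = λ u v →
      let adj⇒meet , meet⇒adj = intersectionGraph⇒represents F isG u v
          Fu⊆ , ⊆Fu = proj₂ (proj₂ (proj₂ (homothetic (from u))))
          Fv⊆ , ⊆Fv = proj₂ (proj₂ (proj₂ (homothetic (from v))))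
      in (λ u~v → let q , Fu , Fv = adj⇒meet u~v in q , Fu⊆ Fu , Fv⊆ Fv)
       , (λ u≢v (q , Hu , Hv) → meet⇒adj u≢v (q , ⊆Fu Hu , ⊆Fv Hv))
  }
  where open FiniteGraph Γ

representation⇒homothetGraph : ∀ {K} Γ → HomothetRepresentation K Γ →
  IntersectionGraphs (HomotheticTo K) (FiniteGraph.graph Γ)
representation⇒homothetGraph {K} Γ rep =
  (λ i → Homothet K (scale (to i)) (shift (to i))) ,
  (λ i → scale (to i) , shift (to i) , 0<scale (to i) , (λ h → h) , (λ h → h)) ,
  represents⇒intersectionGraph (λ v → Homothet K (scale v) (shift v)) represents
  where
  open FiniteGraph Γ
  open HomothetRepresentation rep

-- This is |x - c| ≤ r, kept as two nonnegative quantities ready to be added in certificates.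
Near : ℝ → ℝ → ℝ → Set
Near c r x = 0ℝ ≤ r - (x - c) × 0ℝ ≤ r + (x - c)

Square : ℝ² → ℝ → PlaneSet
Square (cx , cy) r (x , y) = Near cx r x × Near cy r y

record NormalBody (K : PlaneSet) : Set where
  field
    body     : Body K
    square⊆K : ∀ {q} → Square 0² 1ℝ q → K q
  open Body body public

-- The legs of the reference triangle (-2,-2), (4,-2), (-2,4) have length 6. Its hypotenuse is x + y
-- = 2, so it just contains [-1,1]².
⅙ : ℚ
⅙ = ℤ.+ 1 ℚ./ 6

2ℚ 4ℚ : ℚ
2ℚ = 1ℚ ℚ.+ 1ℚ
4ℚ = 2ℚ ℚ.+ 2ℚ

-- The affine map φ takes (-2,-2), (4,-2), (-2,4) to the given triangle, whose preimage
-- therefore contains the square [-1,1]².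
module Normalise {K : PlaneSet} (body : Body K) {p₀ p₁ p₂ : ℝ²} (K₀ : K p₀) (K₁ : K p₁) (K₂ : K p₂)
  {E : ℝ} (inv : det (fromℚ ⅙ • (p₁ -² p₀)) (fromℚ ⅙ • (p₂ -² p₀)) * E ≈ 1ℝ) where

  open Body body

  ux uy vx vy mx my : ℝ
  ux = fromℚ ⅙ * (proj₁ p₁ - proj₁ p₀)
  uy = fromℚ ⅙ * (proj₂ p₁ - proj₂ p₀)
  vx = fromℚ ⅙ * (proj₁ p₂ - proj₁ p₀)
  vy = fromℚ ⅙ * (proj₂ p₂ - proj₂ p₀)
  mx = proj₁ p₀ + fromℚ 2ℚ * ux + fromℚ 2ℚ * vx
  my = proj₂ p₀ + fromℚ 2ℚ * uy + fromℚ 2ℚ * vy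

  inv≈0 : (ux * vy - uy * vx) * E - 1ℝ ≈ 0ℝ
  inv≈0 = ≈⇒-≈0 inv

  -- `L` is the linear part of `φ`, and `Λ` is its inverse by Cramer's rule, with `E` the reciprocal
  -- of the determinant.
  L Λ φ : ℝ² → ℝ²
  L (a , b) = a * ux + b * vx , a * uy + b * vy
  Λ (x , y) = E * (x * vy - y * vx) , E * (ux * y - uy * x)
  φ a = (mx , my) +² L a

  L-Λ : ∀ q → L (Λ q) ≈² q
  L-Λ (x , y) =
    ≈-sym (≈-by (*≈0 x inv≈0) (solve 7 (λ x y ux uy vx vy E →
      x :* ((ux :* vy :- uy :* vx) :* E :- con 1ℚ)
        := E :* (x :* vy :- y :* vx) :* ux :+ E :* (ux :* y :- uy :* x) :* vx :- x) ≈-refl x y ux uy vx vy E)) ,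
    ≈-sym (≈-by (*≈0 y inv≈0) (solve 7 (λ x y ux uy vx vy E →
      y :* ((ux :* vy :- uy :* vx) :* E :- con 1ℚ)
        := E :* (x :* vy :- y :* vx) :* uy :+ E :* (ux :* y :- uy :* x) :* vy :- y) ≈-refl x y ux uy vx vy E))

  L-injective : ∀ {a b} → L a ≈² L b → a ≈² b
  L-injective {a₁ , a₂} {b₁ , b₂} (x≈ , y≈) =
    ≈-sym (≈-by (+≈0 (*≈0 E (+≈0 (*≈0 vy (≈⇒-≈0 x≈)) (*≈0 (- vx) (≈⇒-≈0 y≈)))) (*≈0 (b₁ - a₁) inv≈0))
      (solve 9 (λ a₁ a₂ b₁ b₂ ux uy vx vy E →
        E :* (vy :* ((a₁ :* ux :+ a₂ :* vx) :- (b₁ :* ux :+ b₂ :* vx))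
              :+ (:- vx) :* ((a₁ :* uy :+ a₂ :* vy) :- (b₁ :* uy :+ b₂ :* vy)))
        :+ (b₁ :- a₁) :* ((ux :* vy :- uy :* vx) :* E :- con 1ℚ) := a₁ :- b₁)
        ≈-refl a₁ a₂ b₁ b₂ ux uy vx vy E)) ,
    ≈-sym (≈-by (+≈0 (*≈0 E (+≈0 (*≈0 (- uy) (≈⇒-≈0 x≈)) (*≈0 ux (≈⇒-≈0 y≈)))) (*≈0 (b₂ - a₂) inv≈0))
      (solve 9 (λ a₁ a₂ b₁ b₂ ux uy vx vy E →
        E :* ((:- uy) :* ((a₁ :* ux :+ a₂ :* vx) :- (b₁ :* ux :+ b₂ :* vx))
              :+ ux :* ((a₁ :* uy :+ a₂ :* vy) :- (b₁ :* uy :+ b₂ :* vy)))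
        :+ (b₂ :- a₂) :* ((ux :* vy :- uy :* vx) :* E :- con 1ℚ) := a₂ :- b₂)
        ≈-refl a₁ a₂ b₁ b₂ ux uy vx vy E))

  K′ : PlaneSet
  K′ a = K (φ a)

  φ⁻¹ : ∀ {p} → K p → K′ (Λ (p -² (mx , my)))
  φ⁻¹ {p@(px , py)} Kp = respects Kp
    ( ≈-trans (+-cong ≈-refl (proj₁ (L-Λ (p -² (mx , my))))) (solve 2 (λ p m → m :+ (p :- m) := p) ≈-refl px mx)
    , ≈-trans (+-cong ≈-refl (proj₂ (L-Λ (p -² (mx , my))))) (solve 2 (λ p m → m :+ (p :- m) := p) ≈-refl py my) )

  convex′ : ∀ {p q r z : ℝ²} a b c → K′ p → K′ q → K′ r → 0ℝ ≤ a → 0ℝ ≤ b → 0ℝ ≤ c →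
    a + b + c ≈ 1ℝ → z ≈² a • p +² b • q +² c • r → K′ z
  convex′ {px , py} {qx , qy} {rx , ry} {zx , zy} a b c Kp Kq Kr 0≤a 0≤b 0≤c a+b+c (zx≈ , zy≈) =
    convex a b c Kp Kq Kr 0≤a 0≤b 0≤c a+b+c (coordinate mx ux vx , coordinate my uy vy)
    where
    coordinate : ∀ m u v → m + (zx * u + zy * v) ≈
      a * (m + (px * u + py * v)) + b * (m + (qx * u + qy * v)) + c * (m + (rx * u + ry * v))
    coordinate m u v = ≈-trans (+-cong ≈-refl (+-cong (*-cong zx≈ ≈-refl) (*-cong zy≈ ≈-refl)))
      (≈-by (*≈0 m (≈⇒-≈0 a+b+c)) (solve 12 (λ a b c px py qx qy rx ry m u v →
        m :* (a :+ b :+ c :- con 1ℚ) :=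
        a :* (m :+ (px :* u :+ py :* v)) :+ b :* (m :+ (qx :* u :+ qy :* v)) :+ c :* (m :+ (rx :* u :+ ry :* v))
        :- (m :+ ((a :* px :+ b :* qx :+ c :* rx) :* u :+ (a :* py :+ b :* qy :+ c :* ry) :* v)))
        ≈-refl a b c px py qx qy rx ry m u v))

  extremal′ : ∀ α β → ¬ ¬ (Σ[ p ∈ ℝ² ] K′ p ×
    (∀ {q} → K′ q → α * proj₁ q + β * proj₂ q ≤ α * proj₁ p + β * proj₂ p))
  -- The coefficients are those of the functional (α , β) composed with `Λ`; on `φ a` it takes the
  -- value of (α , β) at `a` up to a constant.
  extremal′ α β k = extremal (E * (α * vy - β * uy)) (E * (β * ux - α * vx)) λ (p@(px , py) , Kp , max) →
    k (Λ (p -² (mx , my)) , φ⁻¹ Kp , λ {(qx , qy)} Kq → ≤-by _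
      (0≤-+ (≤⇒0≤ (max Kq)) (≈0⇒0≤ (*≈0 (α * qx + β * qy) inv≈0)))
      (solve 13 (λ α β px py qx qy ux uy vx vy mx my E →
        E :* (α :* vy :- β :* uy) :* px :+ E :* (β :* ux :- α :* vx) :* py
        :- (E :* (α :* vy :- β :* uy) :* (mx :+ (qx :* ux :+ qy :* vx))
            :+ E :* (β :* ux :- α :* vx) :* (my :+ (qx :* uy :+ qy :* vy)))
        :+ (α :* qx :+ β :* qy) :* ((ux :* vy :- uy :* vx) :* E :- con 1ℚ)
        := α :* (E :* ((px :- mx) :* vy :- (py :- my) :* vx)) :+ β :* (E :* (ux :* (py :- my) :- uy :* (px :- mx)))
        :- (α :* qx :+ β :* qy)) ≈-refl α β px py qx qy ux uy vx vy mx my E))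

  square⊆K′ : ∀ {q} → Square 0² 1ℝ q → K′ q
  -- The weights are the barycentric coordinates of (x , y) in the reference triangle.
  square⊆K′ {x , y} ((x≤1 , -1≤x) , (y≤1 , -1≤y)) = convex
    (fromℚ ⅙ * (fromℚ 2ℚ - x - y)) (fromℚ ⅙ * (fromℚ 2ℚ + x)) (fromℚ ⅙ * (fromℚ 2ℚ + y)) K₀ K₁ K₂
    (0≤-* 0≤⅙ (0≤-resp-≈ (solve 2 (λ x y → (con 1ℚ :- (x :- con 0ℚ)) :+ (con 1ℚ :- (y :- con 0ℚ))
      := con 2ℚ :- x :- y) ≈-refl x y) (0≤-+ x≤1 y≤1)))
    (0≤-* 0≤⅙ (0≤-resp-≈ (2+ x) (0≤-+ (<⇒≤ 0<1) -1≤x)))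
    (0≤-* 0≤⅙ (0≤-resp-≈ (2+ y) (0≤-+ (<⇒≤ 0<1) -1≤y)))
    (solve 2 (λ x y → con ⅙ :* (con 2ℚ :- x :- y) :+ con ⅙ :* (con 2ℚ :+ x) :+ con ⅙ :* (con 2ℚ :+ y)
      := con 1ℚ) ≈-refl x y)
    (coordinate (proj₁ p₀) (proj₁ p₁) (proj₁ p₂) , coordinate (proj₂ p₀) (proj₂ p₁) (proj₂ p₂))
    where
    0≤⅙ : 0ℝ ≤ fromℚ ⅙
    0≤⅙ = <⇒≤ (0<fromℚ (ℚ.positive⁻¹ ⅙))
    2+ : ∀ x → 1ℝ + (1ℝ + (x - 0ℝ)) ≈ fromℚ 2ℚ + x
    2+ = solve 1 (λ x → con 1ℚ :+ (con 1ℚ :+ (x :- con 0ℚ)) := con 2ℚ :+ x) ≈-refl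
    coordinate : ∀ p₀ p₁ p₂ → _
    coordinate p₀ p₁ p₂ = solve 5 (λ x y p₀ p₁ p₂ →
      let u = con ⅙ :* (p₁ :- p₀) ; v = con ⅙ :* (p₂ :- p₀) in
      p₀ :+ con 2ℚ :* u :+ con 2ℚ :* v :+ (x :* u :+ y :* v)
      := con ⅙ :* (con 2ℚ :- x :- y) :* p₀ :+ con ⅙ :* (con 2ℚ :+ x) :* p₁ :+ con ⅙ :* (con 2ℚ :+ y) :* p₂)
      ≈-refl x y p₀ p₁ p₂

  normalBody : NormalBody K′
  normalBody = record
    { body = record { convex = convex′ ; extremal = extremal′ } ; square⊆K = square⊆K′ }

  -- s K + t is the image under L of s K′ + T whenever L T = s m + t.
  homothet⇒ : ∀ {s t T q} → L T ≈² s • (mx , my) +² t → Homothet K s t q →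
    Homothet K′ s T (Λ q)
  homothet⇒ {s} {tx , ty} {Tx , Ty} {q@(qx , qy)} (Tx≈ , Ty≈) (p@(px , py) , Kp , qx≈ , qy≈) =
    a , φ⁻¹ Kp , L-injective
      ( ≈-trans (proj₁ (L-Λ q)) (≈-trans qx≈ (coordinate px mx tx ux vx (proj₁ (L-Λ (p -² (mx , my)))) Tx≈))
      , ≈-trans (proj₂ (L-Λ q)) (≈-trans qy≈ (coordinate py my ty uy vy (proj₂ (L-Λ (p -² (mx , my)))) Ty≈)) )
    where
    a = Λ (p -² (mx , my))
    coordinate : ∀ p m t u v → proj₁ a * u + proj₂ a * v ≈ p - m → Tx * u + Ty * v ≈ s * m + t →
      s * p + t ≈ (s * proj₁ a + Tx) * u + (s * proj₂ a + Ty) * v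
    coordinate p m t u v a≈ T≈ = ≈-trans
      (solve 4 (λ p m t s → s :* p :+ t := s :* (p :- m) :+ (s :* m :+ t)) ≈-refl p m t s)
      (≈-trans (+-cong (*-cong ≈-refl (≈-sym a≈)) (≈-sym T≈))
      (solve 7 (λ a₁ a₂ Tx Ty u v s → s :* (a₁ :* u :+ a₂ :* v) :+ (Tx :* u :+ Ty :* v)
        := (s :* a₁ :+ Tx) :* u :+ (s :* a₂ :+ Ty) :* v) ≈-refl (proj₁ a) (proj₂ a) Tx Ty u v s))

  ⇒homothet : ∀ {s t T q} → L T ≈² s • (mx , my) +² t → Homothet K′ s T q →
    Homothet K s t (L q)
  ⇒homothet {s} {tx , ty} {Tx , Ty} {qx , qy} (Tx≈ , Ty≈) (a@(ax , ay) , K′a , qx≈ , qy≈) =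
    φ a , K′a , coordinate mx tx ux vx Tx≈ , coordinate my ty uy vy Ty≈
    where
    coordinate : ∀ m t u v → Tx * u + Ty * v ≈ s * m + t →
      qx * u + qy * v ≈ s * (m + (ax * u + ay * v)) + t
    coordinate m t u v T≈ = ≈-trans (+-cong (*-cong qx≈ ≈-refl) (*-cong qy≈ ≈-refl))
      (≈-trans (solve 7 (λ ax ay Tx Ty u v s → (s :* ax :+ Tx) :* u :+ (s :* ay :+ Ty) :* v
        := s :* (ax :* u :+ ay :* v) :+ (Tx :* u :+ Ty :* v)) ≈-refl ax ay Tx Ty u v s)
      (≈-trans (+-cong ≈-refl T≈)
      (solve 6 (λ ax ay m t s w → s :* w :+ (s :* m :+ t) := s :* (m :+ w) :+ t)
        ≈-refl ax ay m t s (ax * u + ay * v))))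

  normalise : ∀ {Γ} → HomothetRepresentation K Γ → HomothetRepresentation K′ Γ
  normalise {Γ} rep = record
    { scale = scale
    ; shift = T
    ; 0<scale = 0<scale
    ; represents = λ u v →
        (λ u~v → let q , Hu , Hv = proj₁ (represents u v) u~v in
          Λ q , homothet⇒ (LT u) Hu , homothet⇒ (LT v) Hv)
      , (λ u≢v (q , Hu , Hv) → proj₂ (represents u v) u≢v (L q , ⇒homothet (LT u) Hu , ⇒homothet (LT v) Hv))
    }
    where
    open HomothetRepresentation rep
    T : FiniteGraph.V Γ → ℝ²
    T v = Λ (scale v • (mx , my) +² shift v)
    LT : ∀ v → L (T v) ≈² scale v • (mx , my) +² shift v
    LT v = L-Λ (scale v • (mx , my) +² shift v)

  denormalise : ∀ {Γ} → HomothetRepresentation K′ Γ → HomothetRepresentation K Γ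
  denormalise {Γ} rep = record
    { scale = scale
    ; shift = t
    ; 0<scale = 0<scale
    ; represents = λ u v →
        (λ u~v → let q , Hu , Hv = proj₁ (represents u v) u~v in
          L q , ⇒homothet (Lt u) Hu , ⇒homothet (Lt v) Hv)
      , (λ u≢v (q , Hu , Hv) → proj₂ (represents u v) u≢v (Λ q , homothet⇒ (Lt u) Hu , homothet⇒ (Lt v) Hv))
    }
    where
    open HomothetRepresentation rep
    t : FiniteGraph.V Γ → ℝ²
    t v = L (shift v) -² scale v • (mx , my)
    Lt : ∀ v → L (shift v) ≈² scale v • (mx , my) +² t v
    Lt v = lemma (proj₁ (L (shift v))) (scale v * mx) , lemma (proj₂ (L (shift v))) (scale v * my)
      where
      lemma : ∀ x y → x ≈ y + (x - y)
      lemma = solve 2 (λ x y → x := y :+ (x :- y)) ≈-refl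

-- Representations are carried both ways: (1) brings one from `P` to the normal body, (2) builds one
-- there and brings it back. The ¬ ¬ stems from the reciprocal `E` of a determinant known only to be
-- nonzero.
normal-form : ∀ P → ¬ ¬ (Σ[ K ∈ PlaneSet ] NormalBody K × (∀ Γ →
  ((P hom) (FiniteGraph.graph Γ) → HomothetRepresentation K Γ) ×
  (HomothetRepresentation K Γ → (P hom) (FiniteGraph.graph Γ))))
normal-form record { size = zero ; nondegenerate = () , _ }
normal-form record { size = suc n ; points = v ; nondegenerate = i , j , l , noncollinear } k =
  ≉0⇒inverse det≉0 λ (E , inv) →
    let open Normalise (hull-body v) (vertex∈hull v i) (vertex∈hull v j) (vertex∈hull v l) inv in
    k (K′ , normalBody , λ Γ →
      (λ rep → normalise (homothetGraph⇒representation Γ rep)) ,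
      (λ rep → representation⇒homothetGraph Γ (denormalise rep)))
  where
  det≉0 : ¬ (det (fromℚ ⅙ • (v j -² v i)) (fromℚ ⅙ • (v l -² v i)) ≈ 0ℝ)
  -- Each of the two vectors carries a factor of one sixth, hence 36.
  det≉0 det≈0 = noncollinear (det≈0⇒∥ {p = v j -² v i} {v l -² v i} (≈0-by (*≈0 (fromℚ 36ℚ) det≈0)
    (solve 4 (λ ax ay bx by → con 36ℚ :* (con ⅙ :* ax :* (con ⅙ :* by) :- con ⅙ :* ay :* (con ⅙ :* bx))
      := ax :* by :- ay :* bx)
      ≈-refl (proj₁ (v j -² v i)) (proj₂ (v j -² v i)) (proj₁ (v l -² v i)) (proj₂ (v l -² v i)))))
    where 36ℚ = ℤ.+ 36 ℚ./ 1

-- Squares and bounded bodies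

near-trans : ∀ {c r x c′ r′ r″} → Near c r x → Near c′ r′ c → 0ℝ ≤ r″ - (r + r′) → Near c′ r″ x
near-trans {c} {r} {x} {c′} {r′} {r″} (a , b) (a′ , b′) slack =
  0≤-resp-≈ (solve 6 (λ c r x c′ r′ r″ →
    r″ :- (r :+ r′) :+ (r :- (x :- c)) :+ (r′ :- (c :- c′)) := r″ :- (x :- c′)) ≈-refl c r x c′ r′ r″)
    (0≤-+ (0≤-+ slack a) a′) ,
  0≤-resp-≈ (solve 6 (λ c r x c′ r′ r″ →
    r″ :- (r :+ r′) :+ (r :+ (x :- c)) :+ (r′ :+ (c :- c′)) := r″ :+ (x :- c′)) ≈-refl c r x c′ r′ r″)
    (0≤-+ (0≤-+ slack b) b′)

near-centre : ∀ c {r} → 0ℝ ≤ r → Near c r c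
near-centre c {r} 0≤r =
  0≤-resp-≈ (solve 2 (λ c r → r := r :- (c :- c)) ≈-refl c r) 0≤r ,
  0≤-resp-≈ (solve 2 (λ c r → r := r :+ (c :- c)) ≈-refl c r) 0≤r

near-≤ : ∀ {c r r′ x} → r ≤ r′ → Near c r x → Near c r′ x
near-≤ {c} {r} {r′} r≤r′ near = near-trans near (near-centre c 0≤0)
  (0≤-resp-≈ (solve 2 (λ r r′ → r′ :- r := r′ :- (r :+ con 0ℚ)) ≈-refl r r′) (≤⇒0≤ r≤r′))

-- `ρ` is the loss between inner and outer square: the homothet of scale `r * ρ` fits into the
-- square of half-side `r` and contains the concentric one of half-side `r * ρ`.
record BoundedBody (K : PlaneSet) : Set where
  field
    normalBody : NormalBody K
    R ρ        : ℝ
    ρR≈1       : ρ * R ≈ 1ℝ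
    0<ρ        : 0ℝ < ρ
    ρ≤1        : ρ ≤ 1ℝ
    K⊆square   : ∀ {q} → K q → Square 0² R q
  open NormalBody normalBody public

near-0 : ∀ {r x} → x ≤ r → - x ≤ r → Near 0ℝ r x
near-0 {r} {x} x≤r -x≤r =
  0≤-resp-≈ (solve 2 (λ r x → r :- x := r :- (x :- con 0ℚ)) ≈-refl r x) (≤⇒0≤ x≤r) ,
  0≤-resp-≈ (solve 2 (λ r x → r :- :- x := r :+ (x :- con 0ℚ)) ≈-refl r x) (≤⇒0≤ -x≤r)

square⇒bounded : ∀ {K r} → NormalBody K → 0ℝ ≤ r → (∀ {q} → K q → Square 0² r q) → BoundedBody K
square⇒bounded {K} {r} normal 0≤r K⊆square =
  let ρ , 0<ρ , Rρ≈1 = inverse (0<-+-0≤ 0<1 0≤r) in record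
  { normalBody = normal
  -- Adding one makes `R` invertible and its reciprocal at most one.
  ; R = 1ℝ + r
  ; ρ = ρ
  ; ρR≈1 = ≈-trans (solve 2 (λ r ρ → ρ :* (con 1ℚ :+ r) := (con 1ℚ :+ r) :* ρ) ≈-refl r ρ) Rρ≈1
  ; 0<ρ = 0<ρ
  ; ρ≤1 = ≤-by _ (0≤-+ (0≤-* 0≤r (<⇒≤ 0<ρ)) (≈0⇒0≤ (≈⇒-≈0 (≈-sym Rρ≈1))))
      (solve 2 (λ r ρ → r :* ρ :+ (con 1ℚ :- (con 1ℚ :+ r) :* ρ) := con 1ℚ :- ρ) ≈-refl r ρ)
  ; K⊆square = λ Kq → let nearx , neary = K⊆square Kq in near-≤ r≤1+r nearx , near-≤ r≤1+r neary
  }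
  where
  r≤1+r : r ≤ 1ℝ + r
  r≤1+r = ≤-by 1ℝ (<⇒≤ 0<1) (solve 1 (λ r → con 1ℚ := con 1ℚ :+ r :- r) ≈-refl r)

normal⇒bounded : ∀ {K} → NormalBody K → ¬ ¬ BoundedBody K
normal⇒bounded {K} normal k =
  maximum (λ (x , y) → x) 1ℝ 0ℝ (solve 2 (λ x y → con 1ℚ :* x :+ con 0ℚ :* y := x) ≈-refl) λ a 0≤a x≤a →
  maximum (λ (x , y) → - x) (- 1ℝ) 0ℝ (solve 2 (λ x y → (:- con 1ℚ) :* x :+ con 0ℚ :* y := :- x) ≈-refl) λ b 0≤b -x≤b →
  maximum (λ (x , y) → y) 0ℝ 1ℝ (solve 2 (λ x y → con 0ℚ :* x :+ con 1ℚ :* y := y) ≈-refl) λ c 0≤c y≤c →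
  maximum (λ (x , y) → - y) 0ℝ (- 1ℝ) (solve 2 (λ x y → con 0ℚ :* x :+ (:- con 1ℚ) :* y := :- y) ≈-refl) λ d 0≤d -y≤d →
  -- The sum of the four bounds replaces their maximum; each is nonnegative because the origin lies
  -- in `K`.
  k (square⇒bounded normal (0≤-+ (0≤-+ 0≤a 0≤b) (0≤-+ 0≤c 0≤d)) λ Kq →
    near-0 (≤-trans (x≤a Kq) (≤-by _ (0≤-+ 0≤b (0≤-+ 0≤c 0≤d))
             (solve 4 (λ a b c d → b :+ (c :+ d) := a :+ b :+ (c :+ d) :- a) ≈-refl a b c d)))
           (≤-trans (-x≤b Kq) (≤-by _ (0≤-+ 0≤a (0≤-+ 0≤c 0≤d))
             (solve 4 (λ a b c d → a :+ (c :+ d) := a :+ b :+ (c :+ d) :- b) ≈-refl a b c d))) ,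
    near-0 (≤-trans (y≤c Kq) (≤-by _ (0≤-+ (0≤-+ 0≤a 0≤b) 0≤d)
             (solve 4 (λ a b c d → a :+ b :+ d := a :+ b :+ (c :+ d) :- c) ≈-refl a b c d)))
           (≤-trans (-y≤d Kq) (≤-by _ (0≤-+ (0≤-+ 0≤a 0≤b) 0≤c)
             (solve 4 (λ a b c d → a :+ b :+ c := a :+ b :+ (c :+ d) :- d) ≈-refl a b c d))))
  where
  open NormalBody normal
  0∈K : K 0²
  0∈K = square⊆K (near-centre 0ℝ (<⇒≤ 0<1) , near-centre 0ℝ (<⇒≤ 0<1))
  maximum : (g : ℝ² → ℝ) (α β : ℝ) → (∀ x y → α * x + β * y ≈ g (x , y)) →
    ¬ (∀ M → 0ℝ ≤ M → ¬ (∀ {q} → K q → g q ≤ M))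
  maximum g α β g≈ k = extremal α β λ (p , _ , max) → k (α * proj₁ p + β * proj₂ p)
    (≤-trans (≈⇒≤ (solve 2 (λ α β → con 0ℚ := α :* con 0ℚ :+ β :* con 0ℚ) ≈-refl α β)) (max 0∈K))
    (λ {q} Kq → ≤-trans (≈⇒≤ (≈-sym (g≈ (proj₁ q) (proj₂ q)))) (max Kq))

-- The net as an intersection graph of homothets

¼ : ℚ
¼ = ½ ℚ.* ½

⅛ : ℚ
⅛ = ½ ℚ.* ¼

0<½ : 0ℝ < fromℚ ½
0<½ = 0<fromℚ (ℚ.positive⁻¹ ½)

0<¼ : 0ℝ < fromℚ ¼
0<¼ = 0<fromℚ (ℚ.positive⁻¹ ¼)

0<⅛ : 0ℝ < fromℚ ⅛
0<⅛ = 0<fromℚ (ℚ.positive⁻¹ ⅛)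

module Placement {K : PlaneSet} (bounded : BoundedBody K) where

  open BoundedBody bounded

  0≤ρ : 0ℝ ≤ ρ
  0≤ρ = <⇒≤ 0<ρ

  centre∈K : K 0²
  centre∈K = square⊆K (near-centre 0ℝ (<⇒≤ 0<1) , near-centre 0ℝ (<⇒≤ 0<1))

  shift∈homothet : ∀ s t → Homothet K s t t
  shift∈homothet s (tx , ty) = 0² , centre∈K , lemma tx , lemma ty
    where
    lemma : ∀ t → t ≈ s * 0ℝ + t
    lemma t = solve 2 (λ s t → t := s :* con 0ℚ :+ t) ≈-refl s t

  homothet⊆square : ∀ {r t q} → 0ℝ ≤ r → Homothet K (r * ρ) t q → Square t r q
  homothet⊆square {r} {tx , ty} {qx , qy} 0≤r ((px , py) , Kp , qx≈ , qy≈) =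
    near qx≈ (proj₁ (K⊆square Kp)) , near qy≈ (proj₂ (K⊆square Kp))
    where
    near : ∀ {t p q} → q ≈ r * ρ * p + t → Near 0ℝ R p → Near t r q
    near {t} {p} {q} q≈ (a , b) =
      0≤-resp-≈ (≈-sym (≈-by (+≈0 (*≈0 r (≈⇒-≈0 ρR≈1)) (*≈0 (- 1ℝ) (≈⇒-≈0 (≈-sym q≈)))) (solve 6 (λ r ρ R p q t →
          r :* (ρ :* R :- con 1ℚ) :+ (:- con 1ℚ) :* (r :* ρ :* p :+ t :- q) := (r :* ρ :* (R :- (p :- con 0ℚ)))
            :- (r :- (q :- t))) ≈-refl r ρ R p q t)))
        (0≤-* (0≤-* 0≤r 0≤ρ) a) ,
      0≤-resp-≈ (≈-sym (≈-by (+≈0 (*≈0 r (≈⇒-≈0 ρR≈1)) (≈⇒-≈0 (≈-sym q≈))) (solve 6 (λ r ρ R p q t →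
          r :* (ρ :* R :- con 1ℚ) :+ (r :* ρ :* p :+ t :- q) := (r :* ρ :* (R :+ (p :- con 0ℚ)))
            :- (r :+ (q :- t))) ≈-refl r ρ R p q t)))
        (0≤-* (0≤-* 0≤r 0≤ρ) b)

  square⊆homothet : ∀ {s t q} → 0ℝ < s → Square t s q → Homothet K s t q
  square⊆homothet {s} {tx , ty} {qx , qy} 0<s (nearx , neary) =
    let S , 0<S , sS≈1 = inverse 0<s
        p : ℝ → ℝ → ℝ
        p t q = S * (q - t)
        near : ∀ {t q} → Near t s q → Near 0ℝ 1ℝ (p t q)
        near {t} {q} (a , b) =
          0≤-resp-≈ (≈-sym (≈-by (≈⇒-≈0 sS≈1) (solve 4 (λ s S t q → s :* S :- con 1ℚ
              := S :* (s :- (q :- t)) :- (con 1ℚ :- (S :* (q :- t) :- con 0ℚ))) ≈-refl s S t q)))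
            (0≤-* (<⇒≤ 0<S) a) ,
          0≤-resp-≈ (≈-sym (≈-by (≈⇒-≈0 sS≈1) (solve 4 (λ s S t q → s :* S :- con 1ℚ
              := S :* (s :+ (q :- t)) :- (con 1ℚ :+ (S :* (q :- t) :- con 0ℚ))) ≈-refl s S t q)))
            (0≤-* (<⇒≤ 0<S) b)
        image : ∀ t q → q ≈ s * p t q + t
        image t q = ≈-by (*≈0 (q - t) (≈⇒-≈0 sS≈1)) (solve 4 (λ s S t q → (q :- t) :* (s :* S :- con 1ℚ)
          := s :* (S :* (q :- t)) :+ t :- q) ≈-refl s S t q)
    in (p tx qx , p ty qy) , square⊆K (near nearx , near neary) , image tx qx , image ty qy

  -- Nested homothets for the nodes of a tree, all in the square with centre c and half-side r.

  treeScale : ∀ k → Tree k → ℝ → ℝ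
  treeScale zero    _         r = r * ρ
  treeScale (suc k) root      r = r * ρ
  treeScale (suc k) (left x)  r = treeScale k x (r * ρ * fromℚ ¼)
  treeScale (suc k) (right x) r = treeScale k x (r * ρ * fromℚ ¼)

  -- The root copy contains the square of half-side w = `r * ρ` about `c`. The subtrees live in
  -- squares of half-side w/4 with centres w/2 to either side: both stay inside that square, and a
  -- gap of w/2 separates them.
  treeShift : ∀ k → Tree k → ℝ² → ℝ → ℝ²
  treeShift zero    _         c         r = c
  treeShift (suc k) root      c         r = c
  treeShift (suc k) (left x)  (cx , cy) r = treeShift k x (cx - r * ρ * fromℚ ½ , cy) (r * ρ * fromℚ ¼)
  treeShift (suc k) (right x) (cx , cy) r = treeShift k x (cx + r * ρ * fromℚ ½ , cy) (r * ρ * fromℚ ¼)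

  TreeHomothet : ∀ k → Tree k → ℝ² → ℝ → PlaneSet
  TreeHomothet k x c r = Homothet K (treeScale k x r) (treeShift k x c r)

  0<rρ : ∀ {r} → 0ℝ < r → 0ℝ < r * ρ
  0<rρ 0<r = 0<-* 0<r 0<ρ

  0<rρ/4 : ∀ {r} → 0ℝ < r → 0ℝ < r * ρ * fromℚ ¼
  0<rρ/4 0<r = 0<-* (0<rρ 0<r) 0<¼

  0<treeScale : ∀ k x {r} → 0ℝ < r → 0ℝ < treeScale k x r
  0<treeScale zero    _         0<r = 0<rρ 0<r
  0<treeScale (suc k) root      0<r = 0<rρ 0<r
  0<treeScale (suc k) (left x)  0<r = 0<treeScale k x (0<rρ/4 0<r)
  0<treeScale (suc k) (right x) 0<r = 0<treeScale k x (0<rρ/4 0<r)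

  rρ≤r : ∀ {r} → 0ℝ < r → r * ρ ≤ r
  rρ≤r {r} 0<r = ≤-by _ (0≤-* (<⇒≤ 0<r) (≤⇒0≤ ρ≤1))
    (solve 2 (λ r ρ → r :* (con 1ℚ :- ρ) := r :- r :* ρ) ≈-refl r ρ)

  slack : ∀ {w} → 0ℝ < w → 0ℝ ≤ w - (w * fromℚ ¼ + w * fromℚ ½)
  slack {w} 0<w = 0≤-resp-≈ (solve 1 (λ w → w :* con ¼ := w :- (w :* con ¼ :+ w :* con ½)) ≈-refl w)
    (0≤-* (<⇒≤ 0<w) (<⇒≤ 0<¼))

  left-square⊆ : ∀ {cx cy w q} → 0ℝ < w → Square (cx - w * fromℚ ½ , cy) (w * fromℚ ¼) q → Square (cx , cy) w q
  left-square⊆ {cx} {cy} {w} 0<w (nearx , neary) =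
    near-trans nearx
      ( 0≤-resp-≈ (solve 2 (λ c w → w :* con ½ :+ w :* con ½ := w :* con ½ :- (c :- w :* con ½ :- c)) ≈-refl cx w)
          (0≤-+ 0≤w/2 0≤w/2)
      , 0≤-resp-≈ (solve 2 (λ c w → con 0ℚ := w :* con ½ :+ (c :- w :* con ½ :- c)) ≈-refl cx w) 0≤0) (slack 0<w) ,
    near-trans neary (near-centre cy 0≤w/2) (slack 0<w)
    where
    0≤w/2 : 0ℝ ≤ w * fromℚ ½
    0≤w/2 = 0≤-* (<⇒≤ 0<w) (<⇒≤ 0<½)

  right-square⊆ : ∀ {cx cy w q} → 0ℝ < w → Square (cx + w * fromℚ ½ , cy) (w * fromℚ ¼) q → Square (cx , cy) w q
  right-square⊆ {cx} {cy} {w} 0<w (nearx , neary) =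
    near-trans nearx
      ( 0≤-resp-≈ (solve 2 (λ c w → con 0ℚ := w :* con ½ :- (c :+ w :* con ½ :- c)) ≈-refl cx w) 0≤0
      , 0≤-resp-≈ (solve 2 (λ c w → w :* con ½ :+ w :* con ½ := w :* con ½ :+ (c :+ w :* con ½ :- c)) ≈-refl cx w)
          (0≤-+ 0≤w/2 0≤w/2)) (slack 0<w) ,
    near-trans neary (near-centre cy 0≤w/2) (slack 0<w)
    where
    0≤w/2 : 0ℝ ≤ w * fromℚ ½
    0≤w/2 = 0≤-* (<⇒≤ 0<w) (<⇒≤ 0<½)

  left-right-disjoint : ∀ {cx cy w q} → 0ℝ < w → Square (cx - w * fromℚ ½ , cy) (w * fromℚ ¼) q →
    ¬ Square (cx + w * fromℚ ½ , cy) (w * fromℚ ¼) q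
  left-right-disjoint {cx} {cy} {w} {qx , qy} 0<w ((a , _) , _) ((_ , b) , _) =
    0≤∧<⇒⊥ (0<-* 0<w 0<½) (0≤-+ a b) (solve 3 (λ c w q →
      w :* con ½ :+ ((w :* con ¼ :- (q :- (c :- w :* con ½))) :+ (w :* con ¼ :+ (q :- (c :+ w :* con ½)))) := con 0ℚ)
      ≈-refl cx w qx)

  square-≤ : ∀ {c r r′ q} → r ≤ r′ → Square c r q → Square c r′ q
  square-≤ r≤r′ (nearx , neary) = near-≤ r≤r′ nearx , near-≤ r≤r′ neary

  tree⊆square : ∀ k x {c r q} → 0ℝ < r → TreeHomothet k x c r q → Square c r q
  tree⊆square zero    _         0<r h = homothet⊆square (<⇒≤ 0<r) h
  tree⊆square (suc k) root      0<r h = homothet⊆square (<⇒≤ 0<r) h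
  tree⊆square (suc k) (left x)  0<r h =
    square-≤ (rρ≤r 0<r) (left-square⊆ (0<rρ 0<r) (tree⊆square k x (0<rρ/4 0<r) h))
  tree⊆square (suc k) (right x) 0<r h =
    square-≤ (rρ≤r 0<r) (right-square⊆ (0<rρ 0<r) (tree⊆square k x (0<rρ/4 0<r) h))

  tree-child⊆root : ∀ k x {c r q} → 0ℝ < r → TreeHomothet (suc k) (inj₂ x) c r q →
    TreeHomothet (suc k) root c r q
  tree-child⊆root k (inj₁ x) 0<r h =
    square⊆homothet (0<rρ 0<r) (left-square⊆ (0<rρ 0<r) (tree⊆square k x (0<rρ/4 0<r) h))
  tree-child⊆root k (inj₂ x) 0<r h =
    square⊆homothet (0<rρ 0<r) (right-square⊆ (0<rρ 0<r) (tree⊆square k x (0<rρ/4 0<r) h))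

  treeCentre : ∀ k x c r → TreeHomothet k x c r (treeShift k x c r)
  treeCentre k x c r = shift∈homothet (treeScale k x r) (treeShift k x c r)

  comparable⇒meet : ∀ k x y {c r} → 0ℝ < r → Comparable k x y → TreeHomothet k x c r ≬ TreeHomothet k y c r
  comparable⇒meet (suc k) root      (inj₂ y)  {c} {r} 0<r _ =
    _ , tree-child⊆root k y 0<r (treeCentre (suc k) (inj₂ y) c r) , treeCentre (suc k) (inj₂ y) c r
  comparable⇒meet (suc k) (inj₂ x)  root      {c} {r} 0<r _ =
    _ , treeCentre (suc k) (inj₂ x) c r , tree-child⊆root k x 0<r (treeCentre (suc k) (inj₂ x) c r)
  comparable⇒meet (suc k) (left x)  (left y)  0<r x~y = comparable⇒meet k x y (0<rρ/4 0<r) x~y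
  comparable⇒meet (suc k) (right x) (right y) 0<r x~y = comparable⇒meet k x y (0<rρ/4 0<r) x~y

  meet⇒comparable : ∀ k x y {c r} → 0ℝ < r → x ≢ y → TreeHomothet k x c r ≬ TreeHomothet k y c r → Comparable k x y
  meet⇒comparable zero    tt        tt        0<r x≢y _ = x≢y refl
  meet⇒comparable (suc k) root      root      0<r x≢y _ = x≢y refl
  meet⇒comparable (suc k) root      (inj₂ _)  0<r x≢y _ = tt
  meet⇒comparable (suc k) (inj₂ _)  root      0<r x≢y _ = tt
  meet⇒comparable (suc k) (left x)  (left y)  0<r x≢y m =
    meet⇒comparable k x y (0<rρ/4 0<r) (λ { refl → x≢y refl }) m
  meet⇒comparable (suc k) (right x) (right y) 0<r x≢y m =
    meet⇒comparable k x y (0<rρ/4 0<r) (λ { refl → x≢y refl }) m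
  meet⇒comparable (suc k) (left x)  (right y) 0<r x≢y (q , h , h′) = left-right-disjoint (0<rρ 0<r)
    (tree⊆square k x (0<rρ/4 0<r) h) (tree⊆square k y (0<rρ/4 0<r) h′)
  meet⇒comparable (suc k) (right x) (left y)  0<r x≢y (q , h , h′) = left-right-disjoint (0<rρ 0<r)
    (tree⊆square k y (0<rρ/4 0<r) h′) (tree⊆square k x (0<rρ/4 0<r) h)

  -- The corners of the net are translates of K by the vertices of a triangle; the i-th
  -- functional separates the i-th vertex from the others.

  cornerShift : Fin 3 → ℝ²
  cornerShift 0F = 0ℝ , 0ℝ
  cornerShift 1F = 1ℝ , 0ℝ
  cornerShift 2F = 0ℝ , 1ℝ

  α β : Fin 3 → ℝ
  α 0F = - 1ℝ
  α 1F = 1ℝ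
  α 2F = 0ℝ
  β 0F = - 1ℝ
  β 1F = 0ℝ
  β 2F = 1ℝ

  functional : Fin 3 → ℝ² → ℝ
  functional i (x , y) = α i * x + β i * y

  separation : ∀ i j → i ≢ j → functional i (cornerShift i) - functional i (cornerShift j) - 1ℝ ≈ 0ℝ
  separation 0F 0F i≢j = ⊥-elim (i≢j refl)
  separation 0F 1F _ = solve 0
    (((:- con 1ℚ) :* con 0ℚ :+ (:- con 1ℚ) :* con 0ℚ)
      :- ((:- con 1ℚ) :* con 1ℚ :+ (:- con 1ℚ) :* con 0ℚ) :- con 1ℚ := con 0ℚ) ≈-refl
  separation 0F 2F _ = solve 0
    (((:- con 1ℚ) :* con 0ℚ :+ (:- con 1ℚ) :* con 0ℚ)
      :- ((:- con 1ℚ) :* con 0ℚ :+ (:- con 1ℚ) :* con 1ℚ) :- con 1ℚ := con 0ℚ) ≈-refl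
  separation 1F 0F _ = solve 0
    ((con 1ℚ :* con 1ℚ :+ con 0ℚ :* con 0ℚ)
      :- (con 1ℚ :* con 0ℚ :+ con 0ℚ :* con 0ℚ) :- con 1ℚ := con 0ℚ) ≈-refl
  separation 1F 1F i≢j = ⊥-elim (i≢j refl)
  separation 1F 2F _ = solve 0
    ((con 1ℚ :* con 1ℚ :+ con 0ℚ :* con 0ℚ)
      :- (con 1ℚ :* con 0ℚ :+ con 0ℚ :* con 1ℚ) :- con 1ℚ := con 0ℚ) ≈-refl
  separation 2F 0F _ = solve 0
    ((con 0ℚ :* con 0ℚ :+ con 1ℚ :* con 1ℚ)
      :- (con 0ℚ :* con 0ℚ :+ con 1ℚ :* con 0ℚ) :- con 1ℚ := con 0ℚ) ≈-refl
  separation 2F 1F _ = solve 0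
    ((con 0ℚ :* con 0ℚ :+ con 1ℚ :* con 1ℚ)
      :- (con 0ℚ :* con 1ℚ :+ con 1ℚ :* con 0ℚ) :- con 1ℚ := con 0ℚ) ≈-refl
  separation 2F 2F i≢j = ⊥-elim (i≢j refl)

  -- Each coordinate varies by at most 2R over `K`, and the functional of corner `0F` involves both.
  -- In the other two cases the range of the second coordinate pads the estimate to 4R.
  functional-range : ∀ i {p q} → K p → K q → functional i p - functional i q ≤ fromℚ 4ℚ * R
  functional-range i {px , py} {qx , qy} Kp Kq =
    let (px≤ , ≤px) , (py≤ , ≤py) = K⊆square Kp
        (qx≤ , ≤qx) , (qy≤ , ≤qy) = K⊆square Kq
    in case i px≤ ≤px py≤ ≤py qx≤ ≤qx qy≤ ≤qy
    where
    case : ∀ i → 0ℝ ≤ R - (px - 0ℝ) → 0ℝ ≤ R + (px - 0ℝ) → 0ℝ ≤ R - (py - 0ℝ) → 0ℝ ≤ R + (py - 0ℝ) →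
      0ℝ ≤ R - (qx - 0ℝ) → 0ℝ ≤ R + (qx - 0ℝ) → 0ℝ ≤ R - (qy - 0ℝ) → 0ℝ ≤ R + (qy - 0ℝ) →
      functional i (px , py) - functional i (qx , qy) ≤ fromℚ 4ℚ * R
    case 0F px≤ ≤px py≤ ≤py qx≤ ≤qx qy≤ ≤qy = ≤-by _ (0≤-+ (0≤-+ ≤px qx≤) (0≤-+ ≤py qy≤))
      (solve 5 (λ R px py qx qy →
        ((R :+ (px :- con 0ℚ)) :+ (R :- (qx :- con 0ℚ))) :+ ((R :+ (py :- con 0ℚ)) :+ (R :- (qy :- con 0ℚ)))
        := con 4ℚ :* R :- ((:- con 1ℚ) :* px :+ (:- con 1ℚ) :* py :- ((:- con 1ℚ) :* qx :+ (:- con 1ℚ) :* qy)))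
        ≈-refl R px py qx qy)
    case 1F px≤ ≤px py≤ ≤py qx≤ ≤qx qy≤ ≤qy = ≤-by _ (0≤-+ (0≤-+ px≤ ≤qx) (0≤-+ ≤py py≤))
      (solve 5 (λ R px py qx qy →
        ((R :- (px :- con 0ℚ)) :+ (R :+ (qx :- con 0ℚ))) :+ ((R :+ (py :- con 0ℚ)) :+ (R :- (py :- con 0ℚ)))
        := con 4ℚ :* R :- (con 1ℚ :* px :+ con 0ℚ :* py :- (con 1ℚ :* qx :+ con 0ℚ :* qy)))
        ≈-refl R px py qx qy)
    case 2F px≤ ≤px py≤ ≤py qx≤ ≤qx qy≤ ≤qy = ≤-by _ (0≤-+ (0≤-+ py≤ ≤qy) (0≤-+ ≤px px≤))
      (solve 5 (λ R px py qx qy →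
        ((R :- (py :- con 0ℚ)) :+ (R :+ (qy :- con 0ℚ))) :+ ((R :+ (px :- con 0ℚ)) :+ (R :- (px :- con 0ℚ)))
        := con 4ℚ :* R :- (con 0ℚ :* px :+ con 1ℚ :* py :- (con 0ℚ :* qx :+ con 1ℚ :* qy)))
        ≈-refl R px py qx qy)

  Extreme : Fin 3 → ℝ² → Set
  Extreme i e = K e × (∀ {q} → K q → functional i q ≤ functional i e)

  extreme : ∀ i → ¬ ¬ (Σ[ e ∈ ℝ² ] Extreme i e)
  extreme i = extremal (α i) (β i)

  -- Since `ρ * R ≈ 1ℝ`, a functional varies by at most `δ * 4R`, that is ½, on a copy of scale `δ`:
  -- less than the distance 1 by which it separates the corner shifts.
  δ : ℝ
  δ = ρ * fromℚ ⅛

  0<δ : 0ℝ < δ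
  0<δ = 0<-* 0<ρ 0<⅛

  δ≤1 : δ ≤ 1ℝ
  δ≤1 = ≤-by _ (0≤-+ (≤⇒0≤ ρ≤1) (0≤-* 0≤ρ (<⇒≤ (0<fromℚ (ℚ.positive⁻¹ (1ℚ ℚ.- ⅛))))))
    (solve 1 (λ ρ → (con 1ℚ :- ρ) :+ ρ :* con (1ℚ ℚ.- ⅛) := con 1ℚ :- ρ :* con ⅛) ≈-refl ρ)

  -- The pendant vertex at corner i is a small copy of that corner about its extreme point.
  pendantShift : Fin 3 → ℝ² → ℝ²
  pendantShift i e = (1ℝ - δ) • e +² cornerShift i

  pendant⊆corner : ∀ {i e q} → Extreme i e → Homothet K δ (pendantShift i e) q →
    Homothet K 1ℝ (cornerShift i) q
  pendant⊆corner {i} {e@(ex , ey)} {qx , qy} (Ke , _) (p@(px , py) , Kp , qx≈ , qy≈) =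
    e +² δ • (p -² e) ,
    between δ Ke Kp (<⇒≤ 0<δ) δ≤1 (≈-refl , ≈-refl) ,
    ≈-trans qx≈ (coordinate px ex (proj₁ (cornerShift i))) , ≈-trans qy≈ (coordinate py ey (proj₂ (cornerShift i)))
    where
    coordinate : ∀ p e t → δ * p + ((1ℝ - δ) * e + t) ≈ 1ℝ * (e + δ * (p - e)) + t
    coordinate p e t = solve 4 (λ d p e t → d :* p :+ ((con 1ℚ :- d) :* e :+ t)
      := con 1ℚ :* (e :+ d :* (p :- e)) :+ t) ≈-refl δ p e t

  functional-affine : ∀ i c d {p q t} →
    functional i (c • p +² (d • q +² t)) ≈ c * functional i p + (d * functional i q + functional i t)
  functional-affine i c d {px , py} {qx , qy} {tx , ty} = solve 10 (λ a b c d px py qx qy tx ty →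
    a :* (c :* px :+ (d :* qx :+ tx)) :+ b :* (c :* py :+ (d :* qy :+ ty))
      := c :* (a :* px :+ b :* py) :+ (d :* (a :* qx :+ b :* qy) :+ (a :* tx :+ b :* ty)))
    ≈-refl (α i) (β i) c d px py qx qy tx ty

  functional-translate : ∀ i {p t} → functional i (1ℝ • p +² t) ≈ functional i p + functional i t
  functional-translate i {px , py} {tx , ty} = solve 6 (λ a b px py tx ty →
    a :* (con 1ℚ :* px :+ tx) :+ b :* (con 1ℚ :* py :+ ty) := (a :* px :+ b :* py) :+ (a :* tx :+ b :* ty))
    ≈-refl (α i) (β i) px py tx ty

  functional-cong : ∀ i {p q} → p ≈² q → functional i p ≈ functional i q
  functional-cong i (x≈ , y≈) = +-cong (*-cong ≈-refl x≈) (*-cong ≈-refl y≈)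

  pendant-disjoint : ∀ {i j e q} → i ≢ j → Extreme i e → Homothet K δ (pendantShift i e) q →
    ¬ Homothet K 1ℝ (cornerShift j) q
  pendant-disjoint {i} {j} {e} {q} i≢j (Ke , max) (p , Kp , q≈) (p′ , Kp′ , q≈′) =
    -- At a common point the pendant gives functional `i` at least its value at `e` plus its value
    -- at `cornerShift i`, less ½. Corner `j` gives at most the same sum less 1.
    0≤∧<⇒⊥ 0<½ (0≤-+ (0≤-* (<⇒≤ 0<δ) (≤⇒0≤ (functional-range i Ke Kp))) (≤⇒0≤ (max Kp′)))
      (≈0-by (+≈0 (*≈0 (fromℚ ½) (≈⇒-≈0 ρR≈1))
        (+≈0 (*≈0 (- 1ℝ) (separation i j i≢j)) (≈⇒-≈0 two-values)))
      (solve 7 (λ ρ R fe fp fp′ ft ft′ →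
        con ½ :* (ρ :* R :- con 1ℚ) :+ ((:- con 1ℚ) :* (ft :- ft′ :- con 1ℚ)
          :+ (ρ :* con ⅛ :* fp :+ ((con 1ℚ :- ρ :* con ⅛) :* fe :+ ft) :- (fp′ :+ ft′)))
        := con ½ :+ (ρ :* con ⅛ :* (con 4ℚ :* R :- (fe :- fp)) :+ (fe :- fp′)))
        ≈-refl ρ R (functional i e) (functional i p) (functional i p′)
          (functional i (cornerShift i)) (functional i (cornerShift j))))
    where
    two-values : δ * functional i p + ((1ℝ - δ) * functional i e + functional i (cornerShift i)) ≈
      functional i p′ + functional i (cornerShift j)
    two-values = ≈-trans (≈-sym (functional-affine i δ (1ℝ - δ) {p} {e} {cornerShift i}))
      (≈-trans (functional-cong i {_} {q} (≈-sym (proj₁ q≈) , ≈-sym (proj₂ q≈)))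
      (≈-trans (functional-cong i {q} q≈′) (functional-translate i {p′} {cornerShift j})))

  -- The square of half-side ½ about this point is [0,1]², which lies in all three translates of
  -- [-1,1]² by the corner shifts and so has room for the tree.
  middle : ℝ²
  middle = fromℚ ½ , fromℚ ½

  middle-square⊆corner : ∀ i {q} → Square middle (fromℚ ½) q → Homothet K 1ℝ (cornerShift i) q
  middle-square⊆corner i (nearx , neary) = square⊆homothet 0<1 (case i)
    where
    near₀ : ∀ {x} → Near (fromℚ ½) (fromℚ ½) x → Near 0ℝ 1ℝ x
    near₀ h = near-trans h
      ( 0≤-resp-≈ (solve 0 (con 0ℚ := con ½ :- (con ½ :- con 0ℚ)) ≈-refl) 0≤0
      , 0≤-resp-≈ (solve 0 (con ½ :+ con ½ := con ½ :+ (con ½ :- con 0ℚ)) ≈-refl) (0≤-+ (<⇒≤ 0<½) (<⇒≤ 0<½)))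
      (0≤-resp-≈ (solve 0 (con 0ℚ := con 1ℚ :- (con ½ :+ con ½)) ≈-refl) 0≤0)
    near₁ : ∀ {x} → Near (fromℚ ½) (fromℚ ½) x → Near 1ℝ 1ℝ x
    near₁ h = near-trans h
      ( 0≤-resp-≈ (solve 0 (con ½ :+ con ½ := con ½ :- (con ½ :- con 1ℚ)) ≈-refl) (0≤-+ (<⇒≤ 0<½) (<⇒≤ 0<½))
      , 0≤-resp-≈ (solve 0 (con 0ℚ := con ½ :+ (con ½ :- con 1ℚ)) ≈-refl) 0≤0)
      (0≤-resp-≈ (solve 0 (con 0ℚ := con 1ℚ :- (con ½ :+ con ½)) ≈-refl) 0≤0)
    case : ∀ i → Square (cornerShift i) 1ℝ _
    case 0F = near₀ nearx , near₀ neary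
    case 1F = near₁ nearx , near₀ neary
    case 2F = near₀ nearx , near₁ neary

  middle∈corner : ∀ i → Homothet K 1ℝ (cornerShift i) middle
  middle∈corner i = middle-square⊆corner i {middle} (centred , centred)
    where
    centred : Near (fromℚ ½) (fromℚ ½) (fromℚ ½)
    centred = near-centre (fromℚ ½) (<⇒≤ 0<½)

  another : (i : Fin 3) → ∃[ j ] i ≢ j
  another 0F      = 1F , λ ()
  another (suc i) = 0F , λ ()

  module _ (k : ℕ) (e : Fin 3 → ℝ²) (e-extreme : ∀ i → Extreme i (e i)) where

    open Net k

    scale : Vertex → ℝ
    scale (corner i)  = 1ℝ
    scale (pendant i) = δ
    scale (node x)    = treeScale k x (fromℚ ½)

    shift : Vertex → ℝ²
    shift (corner i)  = cornerShift i
    shift (pendant i) = pendantShift i (e i)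
    shift (node x)    = treeShift k x middle (fromℚ ½)

    H : Vertex → PlaneSet
    H v = Homothet K (scale v) (shift v)

    node⊆corner : ∀ x i {q} → H (node x) q → H (corner i) q
    node⊆corner x i h = middle-square⊆corner i (tree⊆square k x 0<½ h)

    -- Nodes lie inside every corner, so meeting a node would mean meeting a foreign corner.
    pendant-node-disjoint : ∀ i x {q} → H (pendant i) q → ¬ H (node x) q
    pendant-node-disjoint i x h h′ = let j , i≢j = another i in
      pendant-disjoint {i} {j} {e i} i≢j (e-extreme i) h (node⊆corner x j h′)

    pendant∩corner : ∀ i j {q} → H (pendant i) q → H (corner j) q → ¬ (i ≢ j)
    pendant∩corner i j h h′ i≢j = pendant-disjoint {i} {j} {e i} i≢j (e-extreme i) h h′

    centre : ∀ v → H v (shift v)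
    centre v = shift∈homothet (scale v) (shift v)

    net-representation : HomothetRepresentation K net
    net-representation = record
      { scale = scale ; shift = shift ; 0<scale = 0<scale
      ; represents = λ u v → adjacent⇒meet u v , meet⇒adjacent u v }
      where
      0<scale : ∀ v → 0ℝ < scale v
      0<scale (corner i)  = 0<1
      0<scale (pendant i) = 0<δ
      0<scale (node x)    = 0<treeScale k x 0<½

      adjacent⇒meet : ∀ u v → Adjacent u v → H u ≬ H v
      adjacent⇒meet (corner i)  (corner j)  _    = middle , middle∈corner i , middle∈corner j
      adjacent⇒meet (corner i)  (pendant i) refl =
        _ , pendant⊆corner {i} {e i} {shift (pendant i)} (e-extreme i) (centre (pendant i)) , centre (pendant i)
      adjacent⇒meet (corner i)  (node x)    _    =
        _ , node⊆corner x i {shift (node x)} (centre (node x)) , centre (node x)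
      adjacent⇒meet (pendant i) (corner i)  refl =
        _ , centre (pendant i) , pendant⊆corner {i} {e i} {shift (pendant i)} (e-extreme i) (centre (pendant i))
      adjacent⇒meet (pendant _) (pendant _) ()
      adjacent⇒meet (pendant _) (node _)    ()
      adjacent⇒meet (node x)    (corner i)  _    =
        _ , centre (node x) , node⊆corner x i {shift (node x)} (centre (node x))
      adjacent⇒meet (node x)    (node y)    x~y  = comparable⇒meet k x y 0<½ x~y

      meet⇒adjacent : ∀ u v → u ≢ v → H u ≬ H v → Adjacent u v
      meet⇒adjacent (corner i)  (corner j)  u≢v _           = λ { refl → u≢v refl }
      meet⇒adjacent (corner i)  (pendant j) _   (_ , h , h′) = sym (decidable-stable (j Fin.≟ i) (pendant∩corner j i h′ h))
      meet⇒adjacent (corner i)  (node x)    _   _           = tt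
      meet⇒adjacent (pendant i) (corner j)  _   (_ , h , h′) = sym (decidable-stable (i Fin.≟ j) (pendant∩corner i j h h′))
      meet⇒adjacent (pendant i) (pendant j) u≢v (_ , h , h′) =
        pendant∩corner i j h (pendant⊆corner {j} {e j} (e-extreme j) h′) λ { refl → u≢v refl }
      meet⇒adjacent (pendant i) (node x)    _   (_ , h , h′) = pendant-node-disjoint i x h h′
      meet⇒adjacent (node x)    (corner j)  _   _           = tt
      meet⇒adjacent (node x)    (pendant j) _   (_ , h , h′) = pendant-node-disjoint j x h′ h
      meet⇒adjacent (node x)    (node y)    u≢v m           =
        meet⇒comparable k x y 0<½ (λ { refl → u≢v refl }) m

P-hom⊈k-DIR : ∀ P k → ¬ (P hom ⊆ k -DIR)
P-hom⊈k-DIR P k hom⊆dir = normal-form P λ (K , normal , equivalent) → normal⇒bounded normal λ bounded →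
  let open Placement bounded in
  extreme 0F λ (e₀ , extreme₀) → extreme 1F λ (e₁ , extreme₁) → extreme 2F λ (e₂ , extreme₂) →
  Net.net∉k-DIR k (hom⊆dir {FiniteGraph.graph (Net.net k)} (proj₂ (equivalent (Net.net k)) (net-representation k
    (λ { 0F → e₀ ; 1F → e₁ ; 2F → e₂ })
    (λ { 0F → extreme₀ ; 1F → extreme₁ ; 2F → extreme₂ }))))

-- Complete bipartite graphs as grids of segments

CompleteBipartite : ∀ n → Rel (Fin n ⊎ Fin n) 0ℓ
CompleteBipartite n (inj₁ _) (inj₁ _) = ⊥
CompleteBipartite n (inj₁ _) (inj₂ _) = ⊤
CompleteBipartite n (inj₂ _) (inj₁ _) = ⊤
CompleteBipartite n (inj₂ _) (inj₂ _) = ⊥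

completeBipartite-sym : ∀ {n} u v → CompleteBipartite n u v → CompleteBipartite n v u
completeBipartite-sym (inj₁ _) (inj₂ _) _ = tt
completeBipartite-sym (inj₂ _) (inj₁ _) _ = tt

completeBipartite-irrefl : ∀ {n} u {v} → u ≡ v → ¬ CompleteBipartite n u v
completeBipartite-irrefl (inj₁ _) refl ()
completeBipartite-irrefl (inj₂ _) refl ()

completeBipartite : ℕ → FiniteGraph
completeBipartite n = record
  { V = Fin n ⊎ Fin n
  ; indexing = Fin.+↔⊎
  ; _~_ = CompleteBipartite n
  ; _~?_ = λ where
      (inj₁ _) (inj₁ _) → no λ ()
      (inj₁ _) (inj₂ _) → yes tt
      (inj₂ _) (inj₁ _) → yes tt
      (inj₂ _) (inj₂ _) → no λ ()
  ; ~-sym = λ {u} {v} → completeBipartite-sym u v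
  ; ~-irrefl = λ {u} → completeBipartite-irrefl u
  }

ι-mono-< : ∀ {m n} → m ℕ.< n → 0ℝ < ι n - ι m
ι-mono-< {zero}  {suc n} _ = 0<-resp-≈ (solve 1 (λ x → con 1ℚ :+ x := con 1ℚ :+ x :- con 0ℚ) ≈-refl (ι n))
  (0<-+-0≤ 0<1 (0≤ι n))
ι-mono-< {suc m} {suc n} (s≤s m<n) = 0<-resp-≈
  (solve 2 (λ x y → x :- y := con 1ℚ :+ x :- (con 1ℚ :+ y)) ≈-refl (ι n) (ι m)) (ι-mono-< m<n)

ι-injective : ∀ {m n} → ι m ≈ ι n → m ≡ n
ι-injective {m} {n} eq with ℕ.<-cmp m n
... | tri< m<n _ _ = ⊥-elim (0≮0 (0<-resp-≈ (≈⇒-≈0 (≈-sym eq)) (ι-mono-< m<n)))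
... | tri≈ _ m≡n _ = m≡n
... | tri> _ _ n<m = ⊥-elim (0≮0 (0<-resp-≈ (≈⇒-≈0 eq) (ι-mono-< n<m)))

module Grid (m : ℕ) where

  -- A successor, so that the common length `ι n` is positive and the segments have distinct end
  -- points.
  n : ℕ
  n = suc m

  position : Fin n → ℝ
  position i = ι (toℕ i)

  position-injective : ∀ {i j} → position i ≈ position j → i ≡ j
  position-injective eq = Fin.toℕ-injective (ι-injective eq)

  0<ιn : 0ℝ < ι n
  0<ιn = 0<-+-0≤ 0<1 (0≤ι m)

  horizontal vertical : Fin n → PlaneSet
  horizontal i = Segment (0ℝ , position i) (ι n , position i)
  vertical j   = Segment (position j , 0ℝ) (position j , ι n)

  constant-coordinate : ∀ {x c t} → x ≈ c + t * (c - c) → x ≈ c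
  constant-coordinate {c = c} {t} x≈ =
    ≈-trans x≈ (solve 2 (λ c t → c :+ t :* (c :- c) := c) ≈-refl c t)

  varying-coordinate : ∀ i → Σ[ t ∈ ℝ ] 0ℝ ≤ t × t ≤ 1ℝ × position i ≈ 0ℝ + t * (ι n - 0ℝ)
  varying-coordinate i =
    let y , 0<y , ny≈1 = inverse 0<ιn
        x = position i
    in x * y , 0≤-* (0≤ι (toℕ i)) (<⇒≤ 0<y)
     , ≤-by _ (0≤-+ (0≤-* (<⇒≤ (ι-mono-< (Fin.toℕ<n i))) (<⇒≤ 0<y)) (≈0⇒0≤ (≈⇒-≈0 (≈-sym ny≈1))))
         (solve 3 (λ n x y → (n :- x) :* y :+ (con 1ℚ :- n :* y) := con 1ℚ :- x :* y) ≈-refl (ι n) x y)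
     , ≈-by (*≈0 x (≈⇒-≈0 ny≈1)) (solve 3 (λ n x y → x :* (n :* y :- con 1ℚ)
         := con 0ℚ :+ x :* y :* (n :- con 0ℚ) :- x) ≈-refl (ι n) x y)

  fixed-coordinate : ∀ c t → c ≈ c + t * (c - c)
  fixed-coordinate c t = ≈-sym (constant-coordinate {t = t} ≈-refl)

  crossing : ∀ i j → horizontal i (position j , position i) × vertical j (position j , position i)
  crossing i j =
    (let t , 0≤t , t≤1 , eq = varying-coordinate j in t , 0≤t , t≤1 , eq , fixed-coordinate (position i) t) ,
    (let t , 0≤t , t≤1 , eq = varying-coordinate i in t , 0≤t , t≤1 , fixed-coordinate (position j) t , eq)

  segment : Fin n ⊎ Fin n → PlaneSet
  segment (inj₁ i) = horizontal i
  segment (inj₂ j) = vertical j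

  -- `k -DIR` asks for a nonzero vector at each of the k indices but allows parallel ones, so every
  -- index after the first repeats the vertical direction.
  direction : ∀ {k} → Fin (suc (suc k)) → ℝ²
  direction zero    = 1ℝ , 0ℝ
  direction (suc _) = 0ℝ , 1ℝ

  direction≉0 : ∀ {k} (i : Fin (suc (suc k))) → ¬ (direction i ≈² 0²)
  direction≉0 zero    (1≈0 , _) = 0≮0 (0<-resp-≈ 1≈0 0<1)
  direction≉0 (suc _) (_ , 1≈0) = 0≮0 (0<-resp-≈ 1≈0 0<1)

  segment-direction : ∀ {k} v → ∃[ i ] SegmentInDirection (direction {k} i) (segment v)
  segment-direction (inj₁ i) = 0F , _ , _ , (λ (0≈n , _) → 0≮0 (0<-resp-≈ (≈-sym 0≈n) 0<ιn)) ,
    solve 2 (λ n x → (n :- con 0ℚ) :* con 0ℚ := (x :- x) :* con 1ℚ) ≈-refl (ι n) (position i) ,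
    (λ p → p) , (λ p → p)
  segment-direction (inj₂ j) = 1F , _ , _ , (λ (_ , 0≈n) → 0≮0 (0<-resp-≈ (≈-sym 0≈n) 0<ιn)) ,
    solve 2 (λ n x → (x :- x) :* con 1ℚ := (n :- con 0ℚ) :* con 0ℚ) ≈-refl (ι n) (position j) ,
    (λ p → p) , (λ p → p)

  open FiniteGraph (completeBipartite n)

  segments-represent : Represents (λ u v → segment u ≬ segment v)
  segments-represent (inj₁ i) (inj₁ j) = (λ ()) , λ u≢v (_ , (_ , _ , _ , _ , y≈) , (_ , _ , _ , _ , y≈′)) →
    u≢v (cong inj₁ (position-injective (≈-trans (≈-sym (constant-coordinate y≈)) (constant-coordinate y≈′))))
  segments-represent (inj₁ i) (inj₂ j) = (λ _ → _ , crossing i j) , λ _ _ → tt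
  segments-represent (inj₂ j) (inj₁ i) = (λ _ → _ , proj₂ (crossing i j) , proj₁ (crossing i j)) , λ _ _ → tt
  segments-represent (inj₂ i) (inj₂ j) = (λ ()) , λ u≢v (_ , (_ , _ , _ , x≈ , _) , (_ , _ , _ , x≈′ , _)) →
    u≢v (cong inj₂ (position-injective (≈-trans (≈-sym (constant-coordinate x≈)) (constant-coordinate x≈′))))

  completeBipartite∈k-DIR : ∀ {k} → (suc (suc k) -DIR) graph
  completeBipartite∈k-DIR = direction , direction≉0 , segment ∘ to ,
    (λ i → segment-direction (to i)) , represents⇒intersectionGraph segment segments-represent

-- Packing

-- The double negation shift, by induction over the finite index set.
¬¬-choice : ∀ {n} {A : Fin n → Set} → (∀ i → ¬ ¬ A i) → ¬ ¬ (∀ i → A i)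
¬¬-choice {zero}  _ k = k λ ()
¬¬-choice {suc n} a k = a zero λ a₀ → ¬¬-choice (a ∘ suc) λ a₊ → k λ { zero → a₀ ; (suc i) → a₊ i }

InCell : ℕ → ℝ → Set
InCell j x = ι j ≤ x × x ≤ 1ℝ + ι j

-- The cells are closed and share end points, so `≤⊎<` suffices to find one. There are `suc N` of
-- them so that even the point interval at `N` = 0 has a cell.
cell : ∀ N {x} → 0ℝ ≤ x → x ≤ ι N → ¬ ¬ (Σ[ j ∈ Fin (suc N) ] InCell (toℕ j) x)
cell zero    {x} 0≤x x≤0 k = k (zero , 0≤x , ≤-trans x≤0 (≤-by _ (<⇒≤ 0<1)
  (solve 0 (con 1ℚ := con 1ℚ :+ con 0ℚ :- con 0ℚ) ≈-refl)))
cell (suc N) {x} 0≤x x≤N k = ≤⊎< x 1ℝ λ where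
  (inj₁ x≤1) → k (zero , 0≤x , ≤-trans x≤1 (≈⇒≤ (solve 0 (con 1ℚ := con 1ℚ :+ con 0ℚ) ≈-refl)))
  (inj₂ 1<x) → cell N {x - 1ℝ} (≤⇒0≤ (<⇒≤ 1<x))
    (≤-by _ (≤⇒0≤ x≤N) (solve 2 (λ x n → con 1ℚ :+ n :- x := n :- (x :- con 1ℚ)) ≈-refl x (ι N)))
    λ (j , j≤ , ≤j) → k (suc j
      , ≤-by _ (≤⇒0≤ j≤) (solve 2 (λ x j → x :- con 1ℚ :- j := x :- (con 1ℚ :+ j)) ≈-refl x (ι (toℕ j)))
      , ≤-by _ (≤⇒0≤ ≤j) (solve 2 (λ x j → con 1ℚ :+ j :- (x :- con 1ℚ) := con 1ℚ :+ (con 1ℚ :+ j) :- x)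
          ≈-refl x (ι (toℕ j))))

same-cell⇒near : ∀ {j c x y} → InCell j (x + c) → InCell j (y + c) → Near 0ℝ 1ℝ (y - x)
same-cell⇒near {j} {c} {x} {y} (j≤x , x≤j) (j≤y , y≤j) =
  0≤-resp-≈ (solve 4 (λ j c x y → (x :+ c :- j) :+ (con 1ℚ :+ j :- (y :+ c)) := con 1ℚ :- (y :- x :- con 0ℚ))
    ≈-refl (ι j) c x y) (0≤-+ (≤⇒0≤ j≤x) (≤⇒0≤ y≤j)) ,
  0≤-resp-≈ (solve 4 (λ j c x y → (y :+ c :- j) :+ (con 1ℚ :+ j :- (x :+ c)) := con 1ℚ :+ (y :- x :- con 0ℚ))
    ≈-refl (ι j) c x y) (0≤-+ (≤⇒0≤ j≤y) (≤⇒0≤ x≤j))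

module Packing {K : PlaneSet} (bounded : BoundedBody K) where

  open BoundedBody bounded

  -- s K + t contains the copy of s₀ K obtained by shrinking s K + t towards the common
  -- point s₀ p₀ + t₀ = s p + t; the centre of that copy is t₀ + s₀ (p₀ - p).
  shrunk-square⊆ : ∀ {s₀ s t₀ t p₀ p b z} → 0ℝ < s₀ → s₀ ≤ s → s₀ • p₀ +² t₀ ≈² s • p +² t →
    K p → Square 0² 1ℝ b → z ≈² t₀ +² s₀ • ((p₀ -² p) +² b) → Homothet K s t z
  shrunk-square⊆ {s₀} {s} {t₀} {t} {p₀} {p} {b} 0<s₀ s₀≤s (x≈ , y≈) Kp □b (zx≈ , zy≈) =
    let S , 0<S , sS≈1 = inverse 0<s in
    p +² (s₀ * S) • (b -² p) ,
    between (s₀ * S) Kp (square⊆K □b) (0≤-* (<⇒≤ 0<s₀) (<⇒≤ 0<S)) (ratio≤1 S 0<S sS≈1) (≈-refl , ≈-refl) ,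
    coordinate S sS≈1 x≈ zx≈ , coordinate S sS≈1 y≈ zy≈
    where
    0<s : 0ℝ < s
    0<s = 0<-resp-≈ (solve 2 (λ a b → a :+ (b :- a) := b) ≈-refl s₀ s) (0<-+-0≤ 0<s₀ (≤⇒0≤ s₀≤s))
    ratio≤1 : ∀ S → 0ℝ < S → s * S ≈ 1ℝ → s₀ * S ≤ 1ℝ
    ratio≤1 S 0<S sS≈1 = ≤-by _ (0≤-+ (0≤-* (≤⇒0≤ s₀≤s) (<⇒≤ 0<S)) (≈0⇒0≤ (≈⇒-≈0 (≈-sym sS≈1))))
      (solve 3 (λ s₀ s S → (s :- s₀) :* S :+ (con 1ℚ :- s :* S) := con 1ℚ :- s₀ :* S) ≈-refl s₀ s S)
    coordinate : ∀ S → s * S ≈ 1ℝ → ∀ {p p₀ t t₀ b z} → s₀ * p₀ + t₀ ≈ s * p + t →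
      z ≈ t₀ + s₀ * (p₀ - p + b) → z ≈ s * (p + s₀ * S * (b - p)) + t
    coordinate S sS≈1 {p} {p₀} {t} {t₀} {b} eq z≈ = ≈-trans z≈ (≈-by
      (+≈0 (*≈0 (s₀ * (b - p)) (≈⇒-≈0 sS≈1)) (*≈0 (- 1ℝ) (≈⇒-≈0 eq)))
      (solve 8 (λ s₀ s S p p₀ t t₀ b →
        s₀ :* (b :- p) :* (s :* S :- con 1ℚ) :+ (:- con 1ℚ) :* (s₀ :* p₀ :+ t₀ :- (s :* p :+ t))
        := s :* (p :+ s₀ :* S :* (b :- p)) :+ t :- (t₀ :+ s₀ :* (p₀ :- p :+ b)))
        ≈-refl s₀ s S p p₀ t t₀ b))

  -- The shrunk copies have centres `t₀ +² s₀ • τ i` with `τ i` in [-2R,2R]². Shifted by 2R, these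
  -- vectors fall into `suc N * suc N` unit cells. Two in one cell differ by a vector of [-1,1]², so
  -- each of the two copies contains the centre of the other.
  no-packing : ∀ N → fromℚ 4ℚ * R ≤ ι N → ∀ {n} → suc N ℕ.* suc N ℕ.< n →
    ∀ {s₀ t₀} → 0ℝ < s₀ → (s : Fin n → ℝ) (t : Fin n → ℝ²) → (∀ i → s₀ ≤ s i) →
    (∀ i → Homothet K s₀ t₀ ≬ Homothet K (s i) (t i)) →
    ¬ (∀ i j → i ≢ j → ¬ (Homothet K (s i) (t i) ≬ Homothet K (s j) (t j)))
  no-packing N 4R≤N {n} N²<n {s₀} {t₀} 0<s₀ s t s₀≤s meet disjoint =
    ¬¬-choice (λ i → cell N (0≤τ (τx-bounds i)) (τ≤N (τx-bounds i))) λ cellx →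
    ¬¬-choice (λ i → cell N (0≤τ (τy-bounds i)) (τ≤N (τy-bounds i))) λ celly →
    let i , j , i<j , same = Fin.pigeonhole N²<n (λ i → combine (proj₁ (cellx i)) (proj₁ (celly i)))
        samex , samey = Fin.combine-injective (proj₁ (cellx i)) (proj₁ (celly i)) _ _ same
    in disjoint i j (λ i≡j → ℕ.<⇒≢ i<j (cong toℕ i≡j))
      (near⇒meet i j
        (same-cell⇒near {c = fromℚ 2ℚ * R} {proj₁ (τ i)} {proj₁ (τ j)} (proj₂ (cellx i))
          (subst (λ c → InCell (toℕ c) (proj₁ (τ j) + fromℚ 2ℚ * R)) (sym samex) (proj₂ (cellx j)))
        , same-cell⇒near {c = fromℚ 2ℚ * R} {proj₂ (τ i)} {proj₂ (τ j)} (proj₂ (celly i))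
          (subst (λ c → InCell (toℕ c) (proj₂ (τ j) + fromℚ 2ℚ * R)) (sym samey) (proj₂ (celly j)))))
    where
    p₀ p : Fin n → ℝ²
    p₀ i = let _ , (q , _) , _ = meet i in q
    p i = let _ , _ , (q , _) = meet i in q
    Kp₀ : ∀ i → K (p₀ i)
    Kp₀ i = let _ , (_ , Kq , _) , _ = meet i in Kq
    Kp : ∀ i → K (p i)
    Kp i = let _ , _ , (_ , Kq , _) = meet i in Kq
    common : ∀ i → s₀ • p₀ i +² t₀ ≈² s i • p i +² t i
    common i = let _ , (_ , _ , x≈ , y≈) , (_ , _ , x≈′ , y≈′) = meet i in
      ≈-trans (≈-sym x≈) x≈′ , ≈-trans (≈-sym y≈) y≈′
    τ : Fin n → ℝ²
    τ i = p₀ i -² p i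

    Bounded : ℝ → Set
    Bounded x = 0ℝ ≤ x + fromℚ 2ℚ * R × 0ℝ ≤ fromℚ 4ℚ * R - (x + fromℚ 2ℚ * R)
    bounds : ∀ {x y} → Near 0ℝ R x → Near 0ℝ R y → Bounded (x - y)
    bounds {x} {y} (x≤ , ≤x) (y≤ , ≤y) =
      0≤-resp-≈ (solve 3 (λ R x y → (R :+ (x :- con 0ℚ)) :+ (R :- (y :- con 0ℚ)) := x :- y :+ con 2ℚ :* R)
        ≈-refl R x y) (0≤-+ ≤x y≤) ,
      0≤-resp-≈ (solve 3 (λ R x y → (R :- (x :- con 0ℚ)) :+ (R :+ (y :- con 0ℚ))
        := con 4ℚ :* R :- (x :- y :+ con 2ℚ :* R)) ≈-refl R x y) (0≤-+ x≤ ≤y)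
    τx-bounds : ∀ i → Bounded (proj₁ (τ i))
    τx-bounds i = bounds (proj₁ (K⊆square (Kp₀ i))) (proj₁ (K⊆square (Kp i)))
    τy-bounds : ∀ i → Bounded (proj₂ (τ i))
    τy-bounds i = bounds (proj₂ (K⊆square (Kp₀ i))) (proj₂ (K⊆square (Kp i)))
    0≤τ : ∀ {x} → Bounded x → 0ℝ ≤ x + fromℚ 2ℚ * R
    0≤τ = proj₁
    τ≤N : ∀ {x} → Bounded x → x + fromℚ 2ℚ * R ≤ ι N
    τ≤N b = ≤-trans (0≤⇒≤ (proj₂ b)) 4R≤N

    near⇒meet : ∀ i j → Square 0² 1ℝ (τ j -² τ i) → Homothet K (s i) (t i) ≬ Homothet K (s j) (t j)
    near⇒meet i j near =
      -- This is the centre of the shrunk copy of `j`; from the centre of that of `i` it is off by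
      -- `s₀ • (τ j -² τ i)`, which stays within the inner square.
      t₀ +² s₀ • (τ j) ,
      shrunk-square⊆ 0<s₀ (s₀≤s i) (common i) (Kp i) near
        ( coordinate (proj₁ t₀) (proj₁ (τ i)) (proj₁ (τ j)) , coordinate (proj₂ t₀) (proj₂ (τ i)) (proj₂ (τ j)) ) ,
      shrunk-square⊆ {b = 0²} 0<s₀ (s₀≤s j) (common j) (Kp j)
        (near-centre 0ℝ (<⇒≤ 0<1) , near-centre 0ℝ (<⇒≤ 0<1))
        ( coordinate₀ (proj₁ t₀) (proj₁ (τ j)) , coordinate₀ (proj₂ t₀) (proj₂ (τ j)) )
      where
      coordinate : ∀ t a b → t + s₀ * b ≈ t + s₀ * (a + (b - a))
      coordinate t a b = solve 4 (λ s t a b → t :+ s :* b := t :+ s :* (a :+ (b :- a))) ≈-refl s₀ t a b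
      coordinate₀ : ∀ t b → t + s₀ * b ≈ t + s₀ * (b + 0ℝ)
      coordinate₀ t b = solve 3 (λ s t b → t :+ s :* b := t :+ s :* (b :+ con 0ℚ)) ≈-refl s₀ t b

  no-bipartite-representation : ∀ N → fromℚ 4ℚ * R ≤ ι N →
    ¬ HomothetRepresentation K (completeBipartite (suc (suc N ℕ.* suc N)))
  no-bipartite-representation N 4R≤N rep =
    -- Maximising negated scales selects a smallest member on each side; the smaller of the two is
    -- below every scale on the opposite side, which has one member more than there are cells.
    argmax (λ i → - scale (inj₁ i)) λ (i , min₁) → argmax (λ j → - scale (inj₂ j)) λ (j , min₂) →
    ≤⊎< (scale (inj₁ i)) (scale (inj₂ j)) λ where
      (inj₁ sᵢ≤sⱼ) → no-packing N 4R≤N ℕ.≤-refl (0<scale (inj₁ i)) (scale ∘ inj₂) (shift ∘ inj₂)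
        (λ l → ≤-trans sᵢ≤sⱼ (neg-cancel-≤ (min₂ l)))
        (λ l → proj₁ (represents (inj₁ i) (inj₂ l)) tt)
        (λ l m l≢m meet → proj₂ (represents (inj₂ l) (inj₂ m)) (λ { refl → l≢m refl }) meet)
      (inj₂ sⱼ<sᵢ) → no-packing N 4R≤N ℕ.≤-refl (0<scale (inj₂ j)) (scale ∘ inj₁) (shift ∘ inj₁)
        (λ l → ≤-trans (<⇒≤ sⱼ<sᵢ) (neg-cancel-≤ (min₁ l)))
        (λ l → proj₁ (represents (inj₂ j) (inj₁ l)) tt)
        (λ l m l≢m meet → proj₂ (represents (inj₁ l) (inj₁ m)) (λ { refl → l≢m refl }) meet)
    where
    open HomothetRepresentation rep
    neg-cancel-≤ : ∀ {x y} → - y ≤ - x → x ≤ y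
    neg-cancel-≤ {x} {y} h = ≤-by _ (≤⇒0≤ h) (solve 2 (λ x y → :- x :- :- y := y :- x) ≈-refl x y)

k-DIR⊈P-hom : ∀ P k → 2 ℕ.≤ k → ¬ (k -DIR ⊆ P hom)
k-DIR⊈P-hom P (suc (suc k)) _ dir⊆hom = normal-form P λ (K , normal , equivalent) →
  normal⇒bounded normal λ bounded →
  let open BoundedBody bounded
      N , 4R<N = archimedean (fromℚ 4ℚ * R)
      m = suc N ℕ.* suc N
  in Packing.no-bipartite-representation bounded N (<⇒≤ 4R<N)
       (proj₁ (equivalent (completeBipartite (suc m)))
         (dir⊆hom {FiniteGraph.graph (completeBipartite (suc m))} (Grid.completeBipartite∈k-DIR m)))
k-DIR⊈P-hom P (suc zero) (s≤s ())

lemma3 : (P : Polygon) (k : ℕ) → 2 ≤ℕ k → ((k -DIR) ⊈ (P hom)) × ((P hom) ⊈ (k -DIR))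
lemma3 P k 2≤k = k-DIR⊈P-hom P k 2≤k , P-hom⊈k-DIR P k
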